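{- If $p$ is a prime with $p \equiv 3 \pmod 4$, then $S_2(p)$ is infinite.
   Context: For a positive integer $m$, consider the positive rational solutions $(x,y)$ of $x^y = y^{mx}$. $S_2(m)$ denotes the set of such solutions with $x \neq 1$, $y \neq 1$, for which $y = x^{a/b}$ with $a, b$ coprime positive integers satisfying $|a - b| = 2$. -}

module Defs where

open import Data.Nat as ℕ using (ℕ; zero; suc)
open import Data.Nat.Coprimality using (Coprime)
open import Data.Integer as ℤ using (+_)
open import Data.Rational using (ℚ; ↥_; ↧ₙ_; 1ℚ; 0ℚ; _<_; _*_; _/_)
open import Data.Product using (Σ; _×_; ∃; ∃-syntax)
open import Data.Sum using (_⊎_)
open import Data.List using (List)
open import Data.List.Membership.Propositional using (_∉_)
open import Relation.Binary.PropositionalEquality using (_≡_; _≢_)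

-- natural-number powers of rationals
_^ℚ_ : ℚ → ℕ → ℚ
x ^ℚ zero  = 1ℚ
x ^ℚ suc n = x * (x ^ℚ n)

-- For positive rationals x, y, u, v with y = p/q and v = r/s in lowest terms,
-- the real-number equation  x^y = u^v  holds iff  x^(p s) = u^(r q).
PowEq : ℚ → ℚ → ℚ → ℚ → Set
PowEq x y u v = x ^ℚ (ℤ.∣ ↥ y ∣ ℕ.* ↧ₙ v) ≡ u ^ℚ (ℤ.∣ ↥ v ∣ ℕ.* ↧ₙ y)

-- the rational m
ℕtoℚ : ℕ → ℚ
ℕtoℚ m = + m / 1

-- membership in S_2(m): positive rational solutions (x , y) of x^y = y^(m x)
-- with x ≠ 1, y ≠ 1 and y = x^(a/b) (i.e. y^b = x^a, as x, y > 0),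
-- a, b coprime positive integers, |a - b| = 2.
S₂ : ℕ → ℚ × ℚ → Set
S₂ m (x Data.Product., y) =
  (0ℚ < x) × (0ℚ < y) × (x ≢ 1ℚ) × (y ≢ 1ℚ) ×
  PowEq x y y (ℕtoℚ m * x) ×
  ∃[ a ] ∃[ b ] ((0 ℕ.< a) × (0 ℕ.< b) × Coprime a b ×
                 ((a ≡ b ℕ.+ 2) ⊎ (b ≡ a ℕ.+ 2)) ×
                 (y ^ℚ b ≡ x ^ℚ a))

-- a set of pairs is infinite: it escapes every finite list
Infinite : (ℚ × ℚ → Set) → Set
Infinite P = (L : List (ℚ × ℚ)) → ∃[ s ] (P s × s ∉ L)

{-# OPTIONS --safe #-}

-- If y = x^(a/b) then x^y = y^(p x) says y = (a/b) p x, so x = r^b and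
-- y = r^a with r^(a - b) = p a / b. For a = j², b = p k² and j² - p k² = ±2 this
-- holds with r = (j/k)^(±1), and a, b are coprime because j is odd. Distinct such
-- (j, k) give distinct points, since y / (p x) = a / b determines b. Solutions of
-- j² - p k² = ±2 come from Pell's equation: U² - p V² = 1 has a solution with
-- V > 0 (approximate √p by Dirichlet's pigeonhole argument, find two near
-- solutions congruent modulo their common norm, and divide), and descent on U,
-- splitting U² - 1 into coprime factors, ends in j² - p k² = ±2, the alternative
-- j² - p k² = -1 being impossible modulo 4 when p ≡ 3 (mod 4). Composing with
-- (U, V) then yields infinitely many solutions.

module Submission where

open import Defs
open import Data.Nat using (ℕ; _%_)
open import Data.Nat.Primality using (Prime)
open import Relation.Binary.PropositionalEquality using (_≡_)

-- Norms in ℤ[√d]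

module IntegerNorm where

  open import Data.Integer
  open import Data.Integer.Properties
  open import Data.Integer.Tactic.RingSolver using (solve)
  open import Data.List using (_∷_; [])
  open import Relation.Binary.PropositionalEquality
  open import Relation.Nullary using (contradiction)

  norm : ℤ → ℤ → ℤ → ℤ
  norm d x y = x * x - d * (y * y)

  brahmagupta : ∀ d x y u v →
    norm d x y * norm d u v ≡ norm d (x * u + d * y * v) (x * v + y * u)
  brahmagupta d x y u v = begin
    (x * x - d * (y * y)) * (u * u - d * (v * v))  ≡⟨ solve (d ∷ x ∷ y ∷ u ∷ v ∷ []) ⟩
    (x * u + d * y * v) * (x * u + d * y * v) - d * ((x * v + y * u) * (x * v + y * u)) ∎
    where open ≡-Reasoning

  brahmagupta-conjugate : ∀ d x y u v →
    norm d x y * norm d u v ≡ norm d (x * u - d * y * v) (x * v - u * y)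
  brahmagupta-conjugate d x y u v = begin
    (x * x - d * (y * y)) * (u * u - d * (v * v))  ≡⟨ solve (d ∷ x ∷ y ∷ u ∷ v ∷ []) ⟩
    (x * u - d * y * v) * (x * u - d * y * v) - d * ((x * v - u * y) * (x * v - u * y)) ∎
    where open ≡-Reasoning

  norm-scale : ∀ d n x y → norm d (n * x) (n * y) ≡ (n * n) * norm d x y
  norm-scale d n x y = begin
    n * x * (n * x) - d * (n * y * (n * y)) ≡⟨ solve (d ∷ n ∷ x ∷ y ∷ []) ⟩
    n * n * (x * x - d * (y * y))           ∎
    where open ≡-Reasoning

  norm-cross : ∀ d x y u v →
    norm d x y * (v * v) - norm d u v * (y * y) ≡ (x * v - u * y) * (x * v + u * y)
  norm-cross d x y u v = begin
    (x * x - d * (y * y)) * (v * v) - (u * u - d * (v * v)) * (y * y) ≡⟨ solve (d ∷ x ∷ y ∷ u ∷ v ∷ []) ⟩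
    (x * v - u * y) * (x * v + u * y)                                ∎
    where open ≡-Reasoning

  same-norm-collinear : ∀ d N x y u v .{{_ : NonZero N}} → norm d x y ≡ N → norm d u v ≡ N →
    x * v - u * y ≡ 0ℤ → v * v ≡ y * y
  same-norm-collinear d N x y u v N₁ N₂ collinear = i-j≡0⇒i≡j _ _ (*-cancelˡ-≡ N _ _ (begin
    N * (v * v - y * y)                            ≡⟨ solve (N ∷ y ∷ v ∷ []) ⟩
    N * (v * v) - N * (y * y)                      ≡⟨ cong₂ (λ a b → a * (v * v) - b * (y * y)) N₁ N₂ ⟨
    norm d x y * (v * v) - norm d u v * (y * y)    ≡⟨ norm-cross d x y u v ⟩
    (x * v - u * y) * (x * v + u * y)              ≡⟨ cong (_* (x * v + u * y)) collinear ⟩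
    0ℤ * (x * v + u * y)                           ≡⟨ solve (N ∷ x ∷ y ∷ u ∷ v ∷ []) ⟩
    N * 0ℤ                                         ∎))
    where open ≡-Reasoning

  -- (x - y √d) (x′ + y′ √d) / n, for (x, y) and (x′, y′) = (x + n dx, y + n dy)
  -- both of norm σ n, is integral and of norm 1.
  module _ (d σ n x y dx dy : ℤ) .{{_ : NonZero n}} (σ² : σ * σ ≡ 1ℤ)
           (N₁ : norm d x y ≡ σ * n) (N₂ : norm d (x + n * dx) (y + n * dy) ≡ σ * n) where

    private
      x′ y′ : ℤ
      x′ = x + n * dx
      y′ = y + n * dy

      first-coordinate : x * x′ - d * y * y′ ≡ n * (σ + (x * dx - d * y * dy))
      first-coordinate = begin
        x * (x + n * dx) - d * y * (y + n * dy)          ≡⟨ solve (d ∷ n ∷ x ∷ y ∷ dx ∷ dy ∷ []) ⟩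
        (x * x - d * (y * y)) + n * (x * dx - d * y * dy) ≡⟨ cong (_+ n * (x * dx - d * y * dy)) N₁ ⟩
        σ * n + n * (x * dx - d * y * dy)                ≡⟨ solve (d ∷ σ ∷ n ∷ x ∷ y ∷ dx ∷ dy ∷ []) ⟩
        n * (σ + (x * dx - d * y * dy))                  ∎
        where open ≡-Reasoning

      second-coordinate : x * y′ - x′ * y ≡ n * (x * dy - y * dx)
      second-coordinate = begin
        x * (y + n * dy) - (x + n * dx) * y ≡⟨ solve (n ∷ x ∷ y ∷ dx ∷ dy ∷ []) ⟩
        n * (x * dy - y * dx)               ∎
        where open ≡-Reasoning

    congruent-quotient-unit : norm d (σ + (x * dx - d * y * dy)) (x * dy - y * dx) ≡ 1ℤ
    congruent-quotient-unit = *-cancelˡ-≡ (n * n) _ _ (begin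
      n * n * norm d u v                      ≡⟨ norm-scale d n u v ⟨
      norm d (n * u) (n * v)                  ≡⟨ cong₂ (norm d) first-coordinate second-coordinate ⟨
      norm d (x * x′ - d * y * y′) (x * y′ - x′ * y) ≡⟨ brahmagupta-conjugate d x y x′ y′ ⟨
      norm d x y * norm d x′ y′               ≡⟨ cong₂ _*_ N₁ N₂ ⟩
      σ * n * (σ * n)                         ≡⟨ solve (σ ∷ n ∷ []) ⟩
      n * n * (σ * σ)                         ≡⟨ cong (n * n *_) σ² ⟩
      n * n * 1ℤ                              ∎)
      where
      open ≡-Reasoning
      instance
        n²≢0 : NonZero (n * n)
        n²≢0 = i*j≢0 n n
      u v : ℤ
      u = σ + (x * dx - d * y * dy)
      v = x * dy - y * dx

    collinear⇒same-height : x * dy - y * dx ≡ 0ℤ → y′ * y′ ≡ y * y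
    collinear⇒same-height v≡0 = same-norm-collinear d (σ * n) x y x′ y′ N₁ N₂ (begin
      x * y′ - x′ * y         ≡⟨ second-coordinate ⟩
      n * (x * dy - y * dx)   ≡⟨ cong (n *_) v≡0 ⟩
      n * 0ℤ                  ≡⟨ *-zeroʳ n ⟩
      0ℤ                      ∎)
      where
      open ≡-Reasoning
      instance
        σ≢0 : NonZero σ
        σ≢0 = ≢-nonZero {σ} λ { refl → contradiction σ² λ () }
        σn≢0 : NonZero (σ * n)
        σn≢0 = i*j≢0 σ n

  norm-∣∣ : ∀ d x y → norm d x y ≡ norm d (+ ∣ x ∣) (+ ∣ y ∣)
  norm-∣∣ d x y = cong₂ (λ a b → a - d * b) (square-∣∣ x) (square-∣∣ y)
    where
    square-∣∣ : ∀ i → i * i ≡ + ∣ i ∣ * + ∣ i ∣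
    square-∣∣ (+ n)    = refl
    square-∣∣ -[1+ n ] = refl

open import Data.Nat
open import Data.Nat.Properties
open import Data.Nat.Divisibility
open import Data.Nat.DivMod
  using (_%_; _/_; m%n<n; m%n≤m; m≡m%n+[m/n]*n; %-distribˡ-+; %-distribˡ-*; m*n%n≡0; [m+kn]%n≡m%n)
open import Data.Nat.GCD using (GCD; gcd; gcd-GCD; GCD-*; gcd[m,n]∣m; gcd[m,n]∣n; gcd[m,n]≢0)
open import Data.Nat.Coprimality as Coprime
  using (Coprime; coprime-divisor; coprime-+; 1-coprimeTo; GCD≡1⇒coprime)
open import Data.Nat.Primality using (euclidsLemma; prime⇒nonZero; prime⇒nonTrivial)
open import Data.Nat.Induction using (<-rec)
open import Data.Nat.Tactic.RingSolver using (solve; solve-∀)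
open import Data.Integer as ℤ using (ℤ; +_; -[1+_]; ∣_∣; 1ℤ; _◃_)
import Data.Integer.Properties as ℤ
open import Data.Integer.GCD using () renaming (gcd to gcdℤ)
import Data.Integer.Tactic.RingSolver as ℤ-Solver
open import Data.Rational as ℚ using (ℚ; mkℚ; ↥_; ↧_; ↧ₙ_; 0ℚ; 1ℚ)
import Data.Rational.Properties as ℚ
import Data.Rational.Unnormalised as ℚᵘ
open import Data.Fin as Fin using (Fin; toℕ; fromℕ<; combine)
import Data.Fin.Properties as Fin
open import Data.Sign as Sign using (Sign)
open import Data.Product using (∃; ∃-syntax; _×_; _,_; proj₁; proj₂)
import Data.Product.Properties as Product
open import Data.Sum using (_⊎_; inj₁; inj₂; [_,_]′)
open import Data.List using (List; []; _∷_)
open import Data.List.Relation.Unary.Any using (here; there)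
open import Data.List.Membership.Propositional using (_∉_)
open import Algebra.Bundles using (CommutativeRing)
open import Algebra.Properties.CommutativeSemigroup +-commutativeSemigroup using (xy∙z≈xz∙y)
import Algebra.Properties.CommutativeSemigroup ℤ.*-commutativeSemigroup as ℤ*
import Algebra.Properties.Semiring.Exp (CommutativeRing.semiring ℚ.+-*-commutativeRing) as Exp
open import Function using (id; _∘_)
open import Function.Definitions using (Injective)
open import Relation.Binary using (DecidableEquality; tri<; tri≈; tri>)
open import Relation.Binary.PropositionalEquality
open import Relation.Nullary using (¬_; yes; no; contradiction)

open IntegerNorm

-- Squares and square roots

m*m≤n*n⇒m≤n : ∀ {m n} → m * m ≤ n * n → m ≤ n
m*m≤n*n⇒m≤n mm≤nn = ≮⇒≥ λ n<m → <⇒≱ (*-mono-< n<m n<m) mm≤nn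

m*m<n*n⇒m<n : ∀ {m n} → m * m < n * n → m < n
m*m<n*n⇒m<n mm<nn = ≰⇒> λ n≤m → <⇒≱ mm<nn (*-mono-≤ n≤m n≤m)

m*m≡n*n⇒m≡n : ∀ {m n} → m * m ≡ n * n → m ≡ n
m*m≡n*n⇒m≡n mm≡nn =
  ≤-antisym (m*m≤n*n⇒m≤n (≤-reflexive mm≡nn)) (m*m≤n*n⇒m≤n (≤-reflexive (sym mm≡nn)))

isqrt : ∀ n → ∃[ s ] s * s ≤ n × n < suc s * suc s
isqrt zero = 0 , z≤n , s≤s z≤n
isqrt (suc n) with isqrt n
... | s , s²≤n , n<[1+s]² with suc s * suc s ≤? suc n
...   | yes [1+s]²≤1+n = suc s , [1+s]²≤1+n , ≤-<-trans n<[1+s]² (*-mono-< (n<1+n (suc s)) (n<1+n (suc s)))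
...   | no  [1+s]²≰1+n = s , m≤n⇒m≤1+n s²≤n , ≰⇒> [1+s]²≰1+n

NonSquare : ℕ → Set
NonSquare p = ∀ s u → 0 < u → s * s ≢ p * (u * u)

nonSquare⇒1<p : ∀ {p} → NonSquare p → 1 < p
nonSquare⇒1<p {0}           nonSq = contradiction refl (nonSq 0 1 (s≤s z≤n))
nonSquare⇒1<p {1}           nonSq = contradiction refl (nonSq 1 1 (s≤s z≤n))
nonSquare⇒1<p {suc (suc _)} _     = s≤s (s≤s z≤n)

prime⇒nonSquare : ∀ {p} → Prime p → NonSquare p
prime⇒nonSquare {p} p-prime s u 0<u = <-rec P descend u s 0<u
  where
  open ≡-Reasoning
  instance
    p≢0 : NonZero p
    p≢0 = prime⇒nonZero p-prime
  P : ℕ → Set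
  P u = ∀ s → 0 < u → s * s ≢ p * (u * u)
  p∣square⇒p∣ : ∀ {n} → p ∣ n * n → p ∣ n
  p∣square⇒p∣ = [ id , id ]′ ∘ euclidsLemma _ _ p-prime
  descend : ∀ u → (∀ {v} → v < u → P v) → P u
  descend u rec s 0<u s²≡pu² with p∣square⇒p∣ {s} (divides (u * u) (trans s²≡pu² (*-comm p _)))
  ... | divides s′ refl with p∣square⇒p∣ {u} (divides (s′ * s′) (*-cancelˡ-≡ _ _ p (begin
        p * (u * u)          ≡⟨ sym s²≡pu² ⟩
        s′ * p * (s′ * p)    ≡⟨ solve (s′ ∷ p ∷ []) ⟩
        p * (s′ * s′ * p)    ∎)))
  ...   | divides u′ refl = rec u′<u s′ 0<u′ (*-cancelʳ-≡ _ _ p (*-cancelʳ-≡ _ _ p (begin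
        s′ * s′ * p * p          ≡⟨ solve (s′ ∷ p ∷ []) ⟩
        s′ * p * (s′ * p)        ≡⟨ s²≡pu² ⟩
        p * (u′ * p * (u′ * p))  ≡⟨ solve (p ∷ u′ ∷ []) ⟩
        p * (u′ * u′) * p * p    ∎)))
    where
    0<u′ : 0 < u′
    0<u′ = n≢0⇒n>0 λ { refl → <⇒≢ 0<u refl }
    u′<u : u′ < u′ * p
    u′<u = m<m*n u′ p {{>-nonZero 0<u′}} (nonTrivial⇒n>1 p {{prime⇒nonTrivial p-prime}})

signℤ : Sign → ℤ
signℤ s = s ◃ 1

signℤ-square : ∀ s → signℤ s ℤ.* signℤ s ≡ 1ℤ
signℤ-square Sign.+ = refl
signℤ-square Sign.- = refl

-- X² - p Y² = ±n, with the negative side moved over so that no subtraction occurs.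
NormEq : ℕ → Sign → ℕ → ℕ → ℕ → Set
NormEq p Sign.+ X Y n = X * X ≡ p * (Y * Y) + n
NormEq p Sign.- X Y n = p * (Y * Y) ≡ X * X + n

Pell : ℕ → Set
Pell p = ∃[ U ] ∃[ V ] 0 < V × NormEq p Sign.+ U V 1

private
  [i+j]-i≡j : ∀ i j → i ℤ.+ j ℤ.- i ≡ j
  [i+j]-i≡j = ℤ-Solver.solve-∀

  i≡j+[i-j] : ∀ i j → i ≡ j ℤ.+ (i ℤ.- j)
  i≡j+[i-j] = ℤ-Solver.solve-∀

  i-j≡-[j-i] : ∀ i j → i ℤ.- j ≡ ℤ.-1ℤ ℤ.* (j ℤ.- i)
  i-j≡-[j-i] = ℤ-Solver.solve-∀

  ≡+⇒- : ∀ {a b n} → a ≡ b + n → + a ℤ.- + b ≡ + n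
  ≡+⇒- {b = b} {n} refl = trans (cong (ℤ._- + b) (ℤ.pos-+ b n)) ([i+j]-i≡j (+ b) (+ n))

  -⇒≡+ : ∀ {a b n} → + a ℤ.- + b ≡ + n → a ≡ b + n
  -⇒≡+ {a} {b} {n} eq = ℤ.+-injective (begin
    + a                    ≡⟨ i≡j+[i-j] (+ a) (+ b) ⟩
    + b ℤ.+ (+ a ℤ.- + b)  ≡⟨ cong (ℤ._+_ (+ b)) eq ⟩
    + b ℤ.+ + n            ≡⟨ ℤ.pos-+ b n ⟨
    + (b + n)              ∎)
    where open ≡-Reasoning

  norm-pos : ∀ p X Y → norm (+ p) (+ X) (+ Y) ≡ + (X * X) ℤ.- + (p * (Y * Y))
  norm-pos p X Y = cong₂ ℤ._-_ (sym (ℤ.pos-* X X))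
    (trans (cong (+ p ℤ.*_) (sym (ℤ.pos-* Y Y))) (sym (ℤ.pos-* p (Y * Y))))

NormEq⇒norm : ∀ {p X Y n} s → NormEq p s X Y n → norm (+ p) (+ X) (+ Y) ≡ signℤ s ℤ.* + n
NormEq⇒norm {p} {X} {Y} {n} Sign.+ eq = begin
  norm (+ p) (+ X) (+ Y)          ≡⟨ norm-pos p X Y ⟩
  + (X * X) ℤ.- + (p * (Y * Y))   ≡⟨ ≡+⇒- eq ⟩
  + n                             ≡⟨ ℤ.*-identityˡ (+ n) ⟨
  1ℤ ℤ.* + n                      ∎
  where open ≡-Reasoning
NormEq⇒norm {p} {X} {Y} {n} Sign.- eq = begin
  norm (+ p) (+ X) (+ Y)                      ≡⟨ norm-pos p X Y ⟩
  + (X * X) ℤ.- + (p * (Y * Y))               ≡⟨ i-j≡-[j-i] (+ (X * X)) (+ (p * (Y * Y))) ⟩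
  ℤ.-1ℤ ℤ.* (+ (p * (Y * Y)) ℤ.- + (X * X))   ≡⟨ cong (ℤ.-1ℤ ℤ.*_) (≡+⇒- eq) ⟩
  ℤ.-1ℤ ℤ.* + n                               ∎
  where open ≡-Reasoning

norm⇒NormEq : ∀ {p X Y n} s → norm (+ p) (+ X) (+ Y) ≡ signℤ s ℤ.* + n → NormEq p s X Y n
norm⇒NormEq {p} {X} {Y} {n} Sign.+ eq = -⇒≡+ (begin
  + (X * X) ℤ.- + (p * (Y * Y))   ≡⟨ norm-pos p X Y ⟨
  norm (+ p) (+ X) (+ Y)          ≡⟨ eq ⟩
  1ℤ ℤ.* + n                      ≡⟨ ℤ.*-identityˡ (+ n) ⟩
  + n                             ∎)
  where open ≡-Reasoning
norm⇒NormEq {p} {X} {Y} {n} Sign.- eq = -⇒≡+ (begin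
  + (p * (Y * Y)) ℤ.- + (X * X)                           ≡⟨ i-j≡-[j-i] (+ (p * (Y * Y))) (+ (X * X)) ⟩
  ℤ.-1ℤ ℤ.* (+ (X * X) ℤ.- + (p * (Y * Y)))
    ≡⟨ cong (ℤ.-1ℤ ℤ.*_) (trans (sym (norm-pos p X Y)) eq) ⟩
  ℤ.-1ℤ ℤ.* (ℤ.-1ℤ ℤ.* + n)                               ≡⟨ ℤ.*-assoc ℤ.-1ℤ ℤ.-1ℤ (+ n) ⟨
  1ℤ ℤ.* + n                                              ≡⟨ ℤ.*-identityˡ (+ n) ⟩
  + n                                                     ∎)
  where open ≡-Reasoning

NormEq-compose : ∀ {p s X Y n U V} → NormEq p s X Y n → NormEq p Sign.+ U V 1 →
  NormEq p s (X * U + p * Y * V) (X * V + Y * U) n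
NormEq-compose {p} {s} {X} {Y} {n} {U} {V} eq unit = norm⇒NormEq s (begin
  norm P (+ (X * U + p * Y * V)) (+ (X * V + Y * U))     ≡⟨ cong₂ (norm P) cast₁ cast₂ ⟩
  norm P (x ℤ.* u ℤ.+ P ℤ.* y ℤ.* v) (x ℤ.* v ℤ.+ y ℤ.* u) ≡⟨ brahmagupta P x y u v ⟨
  norm P x y ℤ.* norm P u v
    ≡⟨ cong₂ ℤ._*_ (NormEq⇒norm s eq) (NormEq⇒norm {p} {U} {V} Sign.+ unit) ⟩
  signℤ s ℤ.* + n ℤ.* 1ℤ                                 ≡⟨ ℤ.*-identityʳ _ ⟩
  signℤ s ℤ.* + n                                        ∎)
  where
  open ≡-Reasoning
  P x y u v : ℤ
  P = + p
  x = + X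
  y = + Y
  u = + U
  v = + V
  cast₁ : + (X * U + p * Y * V) ≡ x ℤ.* u ℤ.+ P ℤ.* y ℤ.* v
  cast₁ = trans (ℤ.pos-+ (X * U) _) (cong₂ ℤ._+_ (ℤ.pos-* X U)
            (trans (ℤ.pos-* (p * Y) V) (cong (ℤ._* v) (ℤ.pos-* p Y))))
  cast₂ : + (X * V + Y * U) ≡ x ℤ.* v ℤ.+ y ℤ.* u
  cast₂ = trans (ℤ.pos-+ (X * V) _) (cong₂ ℤ._+_ (ℤ.pos-* X V) (ℤ.pos-* Y U))

-- Rational approximation of √p

pigeonhole-ℕ : ∀ {K} (f : ℕ → Fin K) → ∃[ i ] ∃[ j ] i < j × j ≤ K × f i ≡ f j
pigeonhole-ℕ {K} f with Fin.pigeonhole (n<1+n K) (f ∘ toℕ)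
... | i , j , i<j , fi≡fj = toℕ i , toℕ j , i<j , s≤s⁻¹ (Fin.toℕ<n j) , fi≡fj

module SqrtApproximation (p : ℕ) .{{_ : NonZero p}} where

  open ≤-Reasoning

  below-√p-+ : ∀ {a b c d} → c * c ≤ p * (a * a) → d * d ≤ p * (b * b) →
    (c + d) * (c + d) ≤ p * ((a + b) * (a + b))
  below-√p-+ {a} {b} {c} {d} c≤a√p d≤b√p = begin
    (c + d) * (c + d)                              ≡⟨ solve (c ∷ d ∷ []) ⟩
    c * c + d * d + 2 * (c * d)
      ≤⟨ +-mono-≤ (+-mono-≤ c≤a√p d≤b√p) (*-monoʳ-≤ 2 cd≤pab) ⟩
    p * (a * a) + p * (b * b) + 2 * (p * (a * b))  ≡⟨ solve (p ∷ a ∷ b ∷ []) ⟩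
    p * ((a + b) * (a + b))                        ∎
    where
    cd≤pab : c * d ≤ p * (a * b)
    cd≤pab = m*m≤n*n⇒m≤n (begin
      c * d * (c * d)              ≡⟨ solve (c ∷ d ∷ []) ⟩
      c * c * (d * d)              ≤⟨ *-mono-≤ c≤a√p d≤b√p ⟩
      p * (a * a) * (p * (b * b))  ≡⟨ solve (p ∷ a ∷ b ∷ []) ⟩
      p * (a * b) * (p * (a * b))  ∎)

  above-√p-+ : ∀ {a b c d} → p * (a * a) < c * c → p * (b * b) ≤ d * d →
    p * ((a + b) * (a + b)) < (c + d) * (c + d)
  above-√p-+ {a} {b} {c} {d} a√p<c b√p≤d = begin-strict
    p * ((a + b) * (a + b))                        ≡⟨ solve (p ∷ a ∷ b ∷ []) ⟩
    p * (a * a) + p * (b * b) + 2 * (p * (a * b))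
      <⟨ +-mono-<-≤ (+-mono-<-≤ a√p<c b√p≤d) (*-monoʳ-≤ 2 pab≤cd) ⟩
    c * c + d * d + 2 * (c * d)                    ≡⟨ solve (c ∷ d ∷ []) ⟩
    (c + d) * (c + d)                              ∎
    where
    pab≤cd : p * (a * b) ≤ c * d
    pab≤cd = m*m≤n*n⇒m≤n (begin
      p * (a * b) * (p * (a * b))  ≡⟨ solve (p ∷ a ∷ b ∷ []) ⟩
      p * (a * a) * (p * (b * b))  ≤⟨ *-mono-≤ (<⇒≤ a√p<c) b√p≤d ⟩
      c * c * (d * d)              ≡⟨ solve (c ∷ d ∷ []) ⟩
      c * d * (c * d)              ∎)

  below-√p-scale : ∀ N {a c} → c * c ≤ p * (a * a) → N * c * (N * c) ≤ p * (N * a * (N * a))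
  below-√p-scale N {a} {c} c≤a√p = begin
    N * c * (N * c)          ≡⟨ solve (N ∷ c ∷ []) ⟩
    N * N * (c * c)          ≤⟨ *-monoʳ-≤ (N * N) c≤a√p ⟩
    N * N * (p * (a * a))    ≡⟨ solve (N ∷ p ∷ a ∷ []) ⟩
    p * (N * a * (N * a))    ∎

  above-√p-scale : ∀ N .{{_ : NonZero N}} {a c} → p * (a * a) < c * c →
    p * (N * a * (N * a)) < N * c * (N * c)
  above-√p-scale N {a} {c} a√p<c = begin-strict
    p * (N * a * (N * a))    ≡⟨ solve (N ∷ p ∷ a ∷ []) ⟩
    N * N * (p * (a * a))    <⟨ *-monoʳ-< (N * N) {{m*n≢0 N N}} a√p<c ⟩
    N * N * (c * c)          ≡⟨ solve (N ∷ c ∷ []) ⟩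
    N * c * (N * c)          ∎

  ⌊_√p⌋ : ℕ → ℕ
  ⌊ u √p⌋ = proj₁ (isqrt (p * (u * u)))

  ⌊√p⌋-below : ∀ u → ⌊ u √p⌋ * ⌊ u √p⌋ ≤ p * (u * u)
  ⌊√p⌋-below u = proj₁ (proj₂ (isqrt (p * (u * u))))

  ⌊√p⌋-above : ∀ u → p * (u * u) < suc ⌊ u √p⌋ * suc ⌊ u √p⌋
  ⌊√p⌋-above u = proj₂ (proj₂ (isqrt (p * (u * u))))

  ⌊√p⌋-mono-≤ : ∀ {u v} → u ≤ v → ⌊ u √p⌋ ≤ ⌊ v √p⌋
  ⌊√p⌋-mono-≤ {u} {v} u≤v = s≤s⁻¹ (m*m<n*n⇒m<n (begin-strict
    ⌊ u √p⌋ * ⌊ u √p⌋          ≤⟨ ⌊√p⌋-below u ⟩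
    p * (u * u)                ≤⟨ *-monoʳ-≤ p (*-mono-≤ u≤v u≤v) ⟩
    p * (v * v)                <⟨ ⌊√p⌋-above v ⟩
    suc ⌊ v √p⌋ * suc ⌊ v √p⌋  ∎))

  -- c < N Y √p < c + 2 with c = N X - 1, that is |X - Y √p| < 1 / N.
  record Approximation (N : ℕ) : Set where
    field
      X Y c    : ℕ
      0<Y      : 0 < Y
      Y≤N      : Y ≤ N
      NX≡1+c   : N * X ≡ suc c
      c<NY√p   : c * c < p * (N * Y * (N * Y))
      NY√p<2+c : p * (N * Y * (N * Y)) < (2 + c) * (2 + c)

  module _ (N : ℕ) .{{_ : NonZero N}} where

    private
      ⌊N*_√p⌋ : ℕ → ℕ
      ⌊N* y √p⌋ = ⌊ N * y √p⌋

    N*⌊√p⌋≤⌊N*√p⌋ : ∀ y → N * ⌊ y √p⌋ ≤ ⌊N* y √p⌋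
    N*⌊√p⌋≤⌊N*√p⌋ y = s≤s⁻¹ (m*m<n*n⇒m<n (begin-strict
      N * ⌊ y √p⌋ * (N * ⌊ y √p⌋)   ≤⟨ below-√p-scale N (⌊√p⌋-below y) ⟩
      p * (N * y * (N * y))         <⟨ ⌊√p⌋-above (N * y) ⟩
      suc ⌊N* y √p⌋ * suc ⌊N* y √p⌋ ∎))

    ⌊N*√p⌋<N*⌊√p⌋+N : ∀ y → ⌊N* y √p⌋ < N * ⌊ y √p⌋ + N
    ⌊N*√p⌋<N*⌊√p⌋+N y =
      subst (⌊N* y √p⌋ <_) (trans (*-suc N _) (+-comm N _)) (m*m<n*n⇒m<n (begin-strict
      ⌊N* y √p⌋ * ⌊N* y √p⌋               ≤⟨ ⌊√p⌋-below (N * y) ⟩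
      p * (N * y * (N * y))               <⟨ above-√p-scale N (⌊√p⌋-above y) ⟩
      N * suc ⌊ y √p⌋ * (N * suc ⌊ y √p⌋) ∎))

    -- ⌊N · frac (y √p)⌋
    bucket : ℕ → Fin N
    bucket y = fromℕ< (m<n+o⇒m∸n<o ⌊N* y √p⌋ (N * ⌊ y √p⌋) (⌊N*√p⌋<N*⌊√p⌋+N y))

    ⌊N*√p⌋≡N*⌊√p⌋+bucket : ∀ y → ⌊N* y √p⌋ ≡ N * ⌊ y √p⌋ + toℕ (bucket y)
    ⌊N*√p⌋≡N*⌊√p⌋+bucket y = trans (sym (m+[n∸m]≡n (N*⌊√p⌋≤⌊N*√p⌋ y)))
      (cong (_+_ (N * ⌊ y √p⌋)) (sym (Fin.toℕ-fromℕ< _)))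

    module EqualBuckets {i j} (i<j : i < j) (same-bucket : bucket i ≡ bucket j) where

      X Y : ℕ
      X = ⌊ j √p⌋ ∸ ⌊ i √p⌋
      Y = j ∸ i

      0<Y : 0 < Y
      0<Y = m<n⇒0<n∸m i<j

      Nj≡Ni+NY : N * j ≡ N * i + N * Y
      Nj≡Ni+NY = trans (cong (N *_) (sym (m+[n∸m]≡n (<⇒≤ i<j)))) (*-distribˡ-+ N i Y)

      ⌊Nj√p⌋≡⌊Ni√p⌋+NX : ⌊N* j √p⌋ ≡ ⌊N* i √p⌋ + N * X
      ⌊Nj√p⌋≡⌊Ni√p⌋+NX = begin-equality
        ⌊N* j √p⌋                               ≡⟨ ⌊N*√p⌋≡N*⌊√p⌋+bucket j ⟩
        N * ⌊ j √p⌋ + toℕ (bucket j)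
          ≡⟨ cong₂ (λ a b → N * a + toℕ b) ⌊j√p⌋≡⌊i√p⌋+X (sym same-bucket) ⟩
        N * (⌊ i √p⌋ + X) + toℕ (bucket i)      ≡⟨ cong (_+ toℕ (bucket i)) (*-distribˡ-+ N _ X) ⟩
        N * ⌊ i √p⌋ + N * X + toℕ (bucket i)    ≡⟨ xy∙z≈xz∙y (N * ⌊ i √p⌋) _ _ ⟩
        N * ⌊ i √p⌋ + toℕ (bucket i) + N * X    ≡⟨ cong (_+ N * X) (⌊N*√p⌋≡N*⌊√p⌋+bucket i) ⟨
        ⌊N* i √p⌋ + N * X                       ∎
        where
        ⌊j√p⌋≡⌊i√p⌋+X : ⌊ j √p⌋ ≡ ⌊ i √p⌋ + X
        ⌊j√p⌋≡⌊i√p⌋+X = sym (m+[n∸m]≡n (⌊√p⌋-mono-≤ (<⇒≤ i<j)))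

      NY√p<1+NX : p * (N * Y * (N * Y)) < suc (N * X) * suc (N * X)
      NY√p<1+NX = ≰⇒> λ 1+NX≤NY√p → <⇒≱ (⌊√p⌋-above (N * j)) (begin
        suc ⌊N* j √p⌋ * suc ⌊N* j √p⌋
          ≡⟨ cong (λ t → t * t) 1+⌊Nj√p⌋≡⌊Ni√p⌋+[1+NX] ⟩
        (⌊N* i √p⌋ + suc (N * X)) * (⌊N* i √p⌋ + suc (N * X))
          ≤⟨ below-√p-+ {N * i} {N * Y} {⌊N* i √p⌋} (⌊√p⌋-below (N * i)) 1+NX≤NY√p ⟩
        p * ((N * i + N * Y) * (N * i + N * Y))               ≡⟨ cong (λ t → p * (t * t)) Nj≡Ni+NY ⟨
        p * (N * j * (N * j))                                 ∎)
        where
        1+⌊Nj√p⌋≡⌊Ni√p⌋+[1+NX] : suc ⌊N* j √p⌋ ≡ ⌊N* i √p⌋ + suc (N * X)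
        1+⌊Nj√p⌋≡⌊Ni√p⌋+[1+NX] = trans (cong suc ⌊Nj√p⌋≡⌊Ni√p⌋+NX) (sym (+-suc _ _))

      NX≢0 : NonZero (N * X)
      NX≢0 = ≢-nonZero λ NX≡0 → <⇒≱ (subst (λ t → p * (N * Y * (N * Y)) < suc t * suc t) NX≡0 NY√p<1+NX)
        (>-nonZero⁻¹ (p * (N * Y * (N * Y))))
        where
        instance
          Y≢0 : NonZero Y
          Y≢0 = >-nonZero 0<Y
          NY≢0 : NonZero (N * Y)
          NY≢0 = m*n≢0 N Y
          [NY]²≢0 : NonZero (N * Y * (N * Y))
          [NY]²≢0 = m*n≢0 (N * Y) (N * Y)
          p[NY]²≢0 : NonZero (p * (N * Y * (N * Y)))
          p[NY]²≢0 = m*n≢0 p (N * Y * (N * Y))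

      c<NY√p : pred (N * X) * pred (N * X) < p * (N * Y * (N * Y))
      c<NY√p = ≰⇒> λ NY√p≤c → <⇒≱ (begin-strict
        p * (N * j * (N * j))                                  ≡⟨ cong (λ t → p * (t * t)) Nj≡Ni+NY ⟩
        p * ((N * i + N * Y) * (N * i + N * Y))
          <⟨ above-√p-+ {N * i} {N * Y} {suc ⌊N* i √p⌋} (⌊√p⌋-above (N * i)) NY√p≤c ⟩
        (suc ⌊N* i √p⌋ + pred (N * X)) * (suc ⌊N* i √p⌋ + pred (N * X))
          ≡⟨ cong (λ t → t * t) 1+⌊Ni√p⌋+c≡⌊Nj√p⌋ ⟩
        ⌊N* j √p⌋ * ⌊N* j √p⌋                                  ∎) (⌊√p⌋-below (N * j))
        where
        1+⌊Ni√p⌋+c≡⌊Nj√p⌋ : suc ⌊N* i √p⌋ + pred (N * X) ≡ ⌊N* j √p⌋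
        1+⌊Ni√p⌋+c≡⌊Nj√p⌋ = begin-equality
          suc ⌊N* i √p⌋ + pred (N * X)   ≡⟨ +-suc _ _ ⟨
          ⌊N* i √p⌋ + suc (pred (N * X)) ≡⟨ cong (_+_ ⌊N* i √p⌋) (suc-pred (N * X) {{NX≢0}}) ⟩
          ⌊N* i √p⌋ + N * X              ≡⟨ ⌊Nj√p⌋≡⌊Ni√p⌋+NX ⟨
          ⌊N* j √p⌋                      ∎

    approximation : ∀ {i j} → i < j → j ≤ N → bucket i ≡ bucket j → Approximation N
    approximation {i} {j} i<j j≤N same-bucket = record
      { X = X ; Y = Y ; c = pred (N * X) ; 0<Y = 0<Y ; Y≤N = ≤-trans (m∸n≤m j i) j≤N
      ; NX≡1+c = sym (suc-pred (N * X) {{NX≢0}}) ; c<NY√p = c<NY√p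
      ; NY√p<2+c = subst (λ t → p * (N * Y * (N * Y)) < suc t * suc t) (sym (suc-pred (N * X) {{NX≢0}}))
                   NY√p<1+NX }
      where open EqualBuckets i<j same-bucket

  dirichlet : ∀ N .{{_ : NonZero N}} → Approximation N
  dirichlet N with pigeonhole-ℕ (bucket N)
  ... | i , j , i<j , j≤N , same-bucket = approximation N i<j j≤N same-bucket

-- Pell's equation

module PellExistence {p : ℕ} (nonSquare : NonSquare p) where

  instance
    p≢0 : NonZero p
    p≢0 = >-nonZero (<-trans z<s (nonSquare⇒1<p nonSquare))

  open SqrtApproximation p

  normEq-trichotomy : ∀ X Y → 0 < Y → ∃[ s ] ∃[ n ] NormEq p s X Y (suc n)
  normEq-trichotomy X Y 0<Y with <-cmp (X * X) (p * (Y * Y))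
  ... | tri≈ _ X²≡pY² _ = contradiction X²≡pY² (nonSquare X Y 0<Y)
  ... | tri< X²<pY² _ _ = let n , X²+1+n≡pY² = m≤n⇒∃[o]m+o≡n X²<pY² in
                          Sign.- , n , trans (sym X²+1+n≡pY²) (sym (+-suc _ n))
  ... | tri> _ _ pY²<X² = let n , pY²+1+n≡X² = m≤n⇒∃[o]m+o≡n pY²<X² in
                          Sign.+ , n , trans (sym pY²+1+n≡X²) (sym (+-suc _ n))

  module ApproximationBounds {N X Y c : ℕ} .{{_ : NonZero N}} (NX≡1+c : N * X ≡ suc c)
           (c<NY√p : c * c < p * (N * Y * (N * Y)))
           (NY√p<2+c : p * (N * Y * (N * Y)) < (2 + c) * (2 + c)) where

    open ≤-Reasoning

    X≤pY : X ≤ p * Y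
    X≤pY = *-cancelˡ-≤ N (begin
      N * X            ≡⟨ NX≡1+c ⟩
      suc c            ≤⟨ m*m<n*n⇒m<n (begin-strict
                            c * c                          <⟨ c<NY√p ⟩
                            p * (N * Y * (N * Y))          ≤⟨ *-monoˡ-≤ _ (m≤m*n p p) ⟩
                            p * p * (N * Y * (N * Y))      ≡⟨ solve (p ∷ N ∷ Y ∷ []) ⟩
                            p * (N * Y) * (p * (N * Y))    ∎) ⟩
      p * (N * Y)      ≡⟨ solve (p ∷ N ∷ Y ∷ []) ⟩
      N * (p * Y)      ∎)

    -- N² n = |(N X)² - p (N Y)²| < 2 N X + 1, as N Y √p lies within 1 of N X.
    scaled-norm-bound : ∀ s {n} → NormEq p s X Y n → N * n ≤ 2 * X
    scaled-norm-bound Sign.+ {n} X²≡pY²+n = <⇒≤ (*-cancelˡ-< N _ _ (begin-strict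
      N * (N * n)      <⟨ +-cancelˡ-< (p * (N * Y * (N * Y))) _ _ (begin-strict
          p * (N * Y * (N * Y)) + N * (N * n)   ≡⟨ solve (p ∷ N ∷ Y ∷ n ∷ []) ⟩
          N * N * (p * (Y * Y) + n)             ≡⟨ cong (N * N *_) X²≡pY²+n ⟨
          N * N * (X * X)                       ≡⟨ solve (N ∷ X ∷ []) ⟩
          N * X * (N * X)                       ≡⟨ cong (λ t → t * t) NX≡1+c ⟩
          suc c * suc c                         ≡⟨ solve (c ∷ []) ⟩
          c * c + suc (2 * c)                   <⟨ +-monoˡ-< (suc (2 * c)) c<NY√p ⟩
          p * (N * Y * (N * Y)) + suc (2 * c)   ∎) ⟩
      suc (2 * c)      <⟨ n<1+n _ ⟩
      2 + 2 * c        ≡⟨ solve (c ∷ []) ⟩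
      2 * suc c        ≡⟨ cong (2 *_) NX≡1+c ⟨
      2 * (N * X)      ≡⟨ solve (N ∷ X ∷ []) ⟩
      N * (2 * X)      ∎))
    scaled-norm-bound Sign.- {n} pY²≡X²+n =
      *-cancelˡ-≤ N (s≤s⁻¹ (+-cancelˡ-< (N * X * (N * X)) _ _ (begin-strict
      N * X * (N * X) + N * (N * n)         ≡⟨ solve (N ∷ X ∷ n ∷ []) ⟩
      N * N * (X * X + n)                   ≡⟨ cong (N * N *_) pY²≡X²+n ⟨
      N * N * (p * (Y * Y))                 ≡⟨ solve (N ∷ p ∷ Y ∷ []) ⟩
      p * (N * Y * (N * Y))                 <⟨ NY√p<2+c ⟩
      (2 + c) * (2 + c)                     ≡⟨ cong (λ t → suc t * suc t) NX≡1+c ⟨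
      suc (N * X) * suc (N * X)             ≡⟨ solve (N ∷ X ∷ []) ⟩
      N * X * (N * X) + suc (N * (2 * X))   ∎)))

  -- The norm is ±(n + 1) so that residues modulo it need no proof of nonzeroness.
  record NearSolution (M : ℕ) : Set where
    field
      sign   : Sign
      X Y n  : ℕ
      M<Y    : M < Y
      n<2p   : n < 2 * p
      normEq : NormEq p sign X Y (suc n)

  opaque
    nearSolution : ∀ M → NearSolution M
    nearSolution M = record
      { sign = s ; X = X ; Y = Y ; n = n ; normEq = normEq
      ; M<Y = *-cancelˡ-< (2 * p) M Y (begin-strict
          2 * p * M      <⟨ n<1+n _ ⟩
          N              ≤⟨ m≤m*n N (suc n) ⟩
          N * suc n      ≤⟨ N[1+n]≤2X ⟩
          2 * X          ≤⟨ *-monoʳ-≤ 2 X≤pY ⟩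
          2 * (p * Y)    ≡⟨ *-assoc 2 p Y ⟨
          2 * p * Y      ∎)
      ; n<2p = *-cancelʳ-≤ (suc n) (2 * p) N (begin
          suc n * N      ≡⟨ *-comm (suc n) N ⟩
          N * suc n      ≤⟨ N[1+n]≤2X ⟩
          2 * X          ≤⟨ *-monoʳ-≤ 2 (≤-trans X≤pY (*-monoʳ-≤ p Y≤N)) ⟩
          2 * (p * N)    ≡⟨ *-assoc 2 p N ⟨
          2 * p * N      ∎) }
      where
      open ≤-Reasoning
      N : ℕ
      N = suc (2 * p * M)
      open SqrtApproximation.Approximation (dirichlet N)
      open ApproximationBounds {N} {X} {Y} {c} NX≡1+c c<NY√p NY√p<2+c
      s : Sign
      s = proj₁ (normEq-trichotomy X Y 0<Y)
      n : ℕ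
      n = proj₁ (proj₂ (normEq-trichotomy X Y 0<Y))
      normEq : NormEq p s X Y (suc n)
      normEq = proj₂ (proj₂ (normEq-trichotomy X Y 0<Y))
      N[1+n]≤2X : N * suc n ≤ 2 * X
      N[1+n]≤2X = scaled-norm-bound s normEq

  nearSolutions : ℕ → ∃ NearSolution
  nearSolutions zero    = 0 , nearSolution 0
  nearSolutions (suc k) = _ , nearSolution (NearSolution.Y (proj₂ (nearSolutions k)))

  height : ℕ → ℕ
  height k = NearSolution.Y (proj₂ (nearSolutions k))

  height-increasing : ∀ {i j} → i < j → height i < height j
  height-increasing {i} {suc j} i<1+j with m≤n⇒m<n∨m≡n (s≤s⁻¹ i<1+j)
  ... | inj₁ i<j  = <-trans (height-increasing i<j) (NearSolution.M<Y (proj₂ (nearSolutions (suc j))))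
  ... | inj₂ refl = NearSolution.M<Y (proj₂ (nearSolutions (suc i)))

  signIndex : Sign → Fin 2
  signIndex Sign.- = Fin.zero
  signIndex Sign.+ = Fin.suc Fin.zero

  signIndex-injective : ∀ {s t} → signIndex s ≡ signIndex t → s ≡ t
  signIndex-injective {Sign.-} {Sign.-} _ = refl
  signIndex-injective {Sign.+} {Sign.+} _ = refl

  module _ {M} (ns : NearSolution M) where
    open NearSolution ns

    residue< : ∀ z → z % suc n < 2 * p
    residue< z = <-≤-trans (m%n<n z (suc n)) n<2p

    code : Fin (2 * (2 * p * (2 * p * (2 * p))))
    code = combine (signIndex sign)
             (combine (fromℕ< n<2p) (combine (fromℕ< (residue< X)) (fromℕ< (residue< Y))))

  module _ {M₁ M₂} (ns₁ : NearSolution M₁) (ns₂ : NearSolution M₂) where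
    open NearSolution ns₁ renaming (sign to s₁; X to X₁; Y to Y₁; n to n₁)
    open NearSolution ns₂ renaming (sign to s₂; X to X₂; Y to Y₂; n to n₂)

    code-injective : code ns₁ ≡ code ns₂ →
      s₁ ≡ s₂ × n₁ ≡ n₂ × X₁ % suc n₁ ≡ X₂ % suc n₂ × Y₁ % suc n₁ ≡ Y₂ % suc n₂
    code-injective eq =
      let s≡ , rest  = Fin.combine-injective {m = 2} {n = 2 * p * (2 * p * (2 * p))} _ _ _ _ eq
          n≡ , rest′ = Fin.combine-injective {m = 2 * p} {n = 2 * p * (2 * p)} _ _ _ _ rest
          X≡ , Y≡    = Fin.combine-injective {m = 2 * p} {n = 2 * p} _ _ _ _ rest′
      in  signIndex-injective s≡ , Fin.fromℕ<-injective _ _ _ _ n≡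
        , Fin.fromℕ<-injective _ _ _ _ X≡ , Fin.fromℕ<-injective _ _ _ _ Y≡

  ≡-mod⇒shift : ∀ m {a b} → a % suc m ≡ b % suc m →
    + b ≡ + a ℤ.+ + suc m ℤ.* (+ (b / suc m) ℤ.- + (a / suc m))
  ≡-mod⇒shift m {a} {b} a≡b = begin
    + b                                       ≡⟨ decompose b ⟩
    + (b % suc m) ℤ.+ + (b / suc m) ℤ.* + suc m ≡⟨ cong (λ r → + r ℤ.+ + (b / suc m) ℤ.* + suc m) a≡b ⟨
    + (a % suc m) ℤ.+ + (b / suc m) ℤ.* + suc m
      ≡⟨ regroup (+ (a % suc m)) (+ (a / suc m)) (+ (b / suc m)) (+ suc m) ⟩
    + (a % suc m) ℤ.+ + (a / suc m) ℤ.* + suc m ℤ.+ + suc m ℤ.* (+ (b / suc m) ℤ.- + (a / suc m))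
      ≡⟨ cong (ℤ._+ + suc m ℤ.* (+ (b / suc m) ℤ.- + (a / suc m))) (decompose a) ⟨
    + a ℤ.+ + suc m ℤ.* (+ (b / suc m) ℤ.- + (a / suc m)) ∎
    where
    open ≡-Reasoning
    decompose : ∀ z → + z ≡ + (z % suc m) ℤ.+ + (z / suc m) ℤ.* + suc m
    decompose z = trans (cong +_ (m≡m%n+[m/n]*n z (suc m)))
      (trans (ℤ.pos-+ (z % suc m) _) (cong (ℤ._+_ (+ (z % suc m))) (ℤ.pos-* (z / suc m) (suc m))))
    regroup : ∀ r q q′ n → r ℤ.+ q′ ℤ.* n ≡ r ℤ.+ q ℤ.* n ℤ.+ n ℤ.* (q′ ℤ.- q)
    regroup = ℤ-Solver.solve-∀

  pell-from-congruent-pair : ∀ {s m X₁ Y₁ X₂ Y₂} → NormEq p s X₁ Y₁ (suc m) → NormEq p s X₂ Y₂ (suc m) →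
    X₁ % suc m ≡ X₂ % suc m → Y₁ % suc m ≡ Y₂ % suc m → Y₁ < Y₂ → Pell p
  pell-from-congruent-pair {s} {m} {X₁} {Y₁} {X₂} {Y₂} N₁ N₂ X₁≡X₂ Y₁≡Y₂ Y₁<Y₂ =
    ∣ u ∣ , ∣ v ∣ , n≢0⇒n>0 ∣v∣≢0 ,
    norm⇒NormEq {p} {∣ u ∣} {∣ v ∣} Sign.+ (trans (sym (norm-∣∣ (+ p) u v)) unit)
    where
    open ≡-Reasoning
    n dx dy u v : ℤ
    n  = + suc m
    dx = + (X₂ / suc m) ℤ.- + (X₁ / suc m)
    dy = + (Y₂ / suc m) ℤ.- + (Y₁ / suc m)
    u  = signℤ s ℤ.+ (+ X₁ ℤ.* dx ℤ.- + p ℤ.* + Y₁ ℤ.* dy)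
    v  = + X₁ ℤ.* dy ℤ.- + Y₁ ℤ.* dx
    X₂≡ : + X₂ ≡ + X₁ ℤ.+ n ℤ.* dx
    X₂≡ = ≡-mod⇒shift m {X₁} X₁≡X₂
    Y₂≡ : + Y₂ ≡ + Y₁ ℤ.+ n ℤ.* dy
    Y₂≡ = ≡-mod⇒shift m {Y₁} Y₁≡Y₂
    N₁′ : norm (+ p) (+ X₁) (+ Y₁) ≡ signℤ s ℤ.* n
    N₁′ = NormEq⇒norm s N₁
    N₂′ : norm (+ p) (+ X₁ ℤ.+ n ℤ.* dx) (+ Y₁ ℤ.+ n ℤ.* dy) ≡ signℤ s ℤ.* n
    N₂′ = subst₂ (λ x y → norm (+ p) x y ≡ signℤ s ℤ.* n) X₂≡ Y₂≡ (NormEq⇒norm s N₂)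
    unit : norm (+ p) u v ≡ ℤ.1ℤ
    unit = congruent-quotient-unit (+ p) (signℤ s) n (+ X₁) (+ Y₁) dx dy (signℤ-square s) N₁′ N₂′
    ∣v∣≢0 : ∣ v ∣ ≢ 0
    ∣v∣≢0 ∣v∣≡0 = <⇒≢ Y₁<Y₂ (sym (m*m≡n*n⇒m≡n (ℤ.+-injective (begin
      + (Y₂ * Y₂)                                  ≡⟨ ℤ.pos-* Y₂ Y₂ ⟩
      + Y₂ ℤ.* + Y₂                                ≡⟨ cong (λ y → y ℤ.* y) Y₂≡ ⟩
      (+ Y₁ ℤ.+ n ℤ.* dy) ℤ.* (+ Y₁ ℤ.+ n ℤ.* dy)  ≡⟨ collinear⇒same-height (+ p) (signℤ s) n (+ X₁) (+ Y₁) dx dy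
                                                        (signℤ-square s) N₁′ N₂′ (ℤ.∣i∣≡0⇒i≡0 ∣v∣≡0) ⟩
      + Y₁ ℤ.* + Y₁                                ≡⟨ ℤ.pos-* Y₁ Y₁ ⟨
      + (Y₁ * Y₁)                                  ∎))))

  pell-from-equal-codes : ∀ {M₁ M₂} (ns₁ : NearSolution M₁) (ns₂ : NearSolution M₂) →
    code ns₁ ≡ code ns₂ → NearSolution.Y ns₁ < NearSolution.Y ns₂ → Pell p
  pell-from-equal-codes ns₁ ns₂ same-code Y₁<Y₂ =
    let s≡ , n≡ , X≡ , Y≡ = code-injective ns₁ ns₂ same-code
        at-modulus : ∀ z → z % suc (NearSolution.n ns₂) ≡ z % suc (NearSolution.n ns₁)
        at-modulus z = cong (λ k → z % suc k) (sym n≡)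
    in  pell-from-congruent-pair (NearSolution.normEq ns₁)
          (subst₂ (λ s k → NormEq p s (NearSolution.X ns₂) (NearSolution.Y ns₂) (suc k)) (sym s≡) (sym n≡)
            (NearSolution.normEq ns₂))
          (trans X≡ (at-modulus (NearSolution.X ns₂))) (trans Y≡ (at-modulus (NearSolution.Y ns₂))) Y₁<Y₂

  opaque
    pell : Pell p
    pell with pigeonhole-ℕ (code ∘ proj₂ ∘ nearSolutions)
    ... | i , j , i<j , _ , same-code =
      pell-from-equal-codes (proj₂ (nearSolutions i)) (proj₂ (nearSolutions j)) same-code (height-increasing i<j)

-- Descent to X² - p Y² = ±2

data EvenOrOdd : ℕ → Set where
  even : ∀ a → EvenOrOdd (2 * a)
  odd  : ∀ a → EvenOrOdd (1 + 2 * a)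

evenOrOdd : ∀ n → EvenOrOdd n
evenOrOdd zero = even 0
evenOrOdd (suc n) with evenOrOdd n
... | even a = odd a
... | odd a  = subst EvenOrOdd (cong suc (+-suc a (a + 0))) (even (suc a))

coprime-consecutive : ∀ a → Coprime a (a + 1)
coprime-consecutive a = Coprime.sym (coprime-+ (1-coprimeTo a))

odd-coprime-2 : ∀ a → Coprime (1 + 2 * a) 2
odd-coprime-2 zero    = 1-coprimeTo 2
odd-coprime-2 (suc a) = subst (λ m → Coprime m 2) 2+odd≡odd (coprime-+ (odd-coprime-2 a))
  where
  2+odd≡odd : 2 + (1 + 2 * a) ≡ 1 + 2 * suc a
  2+odd≡odd = solve (a ∷ [])

odd-coprime-+2 : ∀ a → Coprime (1 + 2 * a) (1 + 2 * a + 2)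
odd-coprime-+2 a = Coprime.sym (coprime-+ (Coprime.sym (odd-coprime-2 a)))

private
  cofactor≡gcd : ∀ {a′ b c′ g} .{{_ : NonZero g}} → Coprime a′ c′ → Coprime g b →
    a′ * g * b ≡ c′ * g * (c′ * g) → a′ ≡ g
  cofactor≡gcd {a′} {b} {c′} {g} a′⊥c′ g⊥b a′gb≡[c′g]² = ∣-antisym a′∣g g∣a′
    where
    a′b≡c′c′g : a′ * b ≡ c′ * (c′ * g)
    a′b≡c′c′g = *-cancelˡ-≡ _ _ g (begin
      g * (a′ * b)         ≡⟨ solve (a′ ∷ b ∷ g ∷ []) ⟩
      a′ * g * b           ≡⟨ a′gb≡[c′g]² ⟩
      c′ * g * (c′ * g)    ≡⟨ solve (c′ ∷ g ∷ []) ⟩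
      g * (c′ * (c′ * g))  ∎)
      where open ≡-Reasoning
    a′∣g : a′ ∣ g
    a′∣g = coprime-divisor a′⊥c′ (coprime-divisor a′⊥c′
             (divides b (trans (sym a′b≡c′c′g) (*-comm a′ b))))
    g∣a′ : g ∣ a′
    g∣a′ = coprime-divisor g⊥b
             (divides (c′ * c′) (trans (*-comm b a′) (trans a′b≡c′c′g (sym (*-assoc c′ c′ g)))))

coprime-product-square : ∀ {a b c} → Coprime a b → a * b ≡ c * c → ∃[ r ] a ≡ r * r
coprime-product-square {zero}      _   _ = 0 , refl
coprime-product-square {a@(suc _)} {b} {c} a⊥b ab≡c² = g , (begin
  a       ≡⟨ a≡a′g ⟩
  a′ * g  ≡⟨ cong (_* g) (cofactor≡gcd a′⊥c′ g⊥b a′gb≡[c′g]²) ⟩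
  g * g   ∎)
  where
  open ≡-Reasoning
  g a′ c′ : ℕ
  g  = gcd a c
  a′ = quotient (gcd[m,n]∣m a c)
  c′ = quotient (gcd[m,n]∣n a c)
  instance
    g≢0 : NonZero g
    g≢0 = ≢-nonZero (gcd[m,n]≢0 a c (inj₁ λ ()))
  a≡a′g : a ≡ a′ * g
  a≡a′g = m∣n⇒n≡quotient*m (gcd[m,n]∣m a c)
  c≡c′g : c ≡ c′ * g
  c≡c′g = m∣n⇒n≡quotient*m (gcd[m,n]∣n a c)
  a′⊥c′ : Coprime a′ c′
  a′⊥c′ = GCD≡1⇒coprime (GCD-* (subst₂ (λ x y → GCD x y (1 * g)) a≡a′g c≡c′g
            (subst (GCD a c) (sym (*-identityˡ g)) (gcd-GCD a c))))
  g⊥b : Coprime g b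
  g⊥b (d∣g , d∣b) = a⊥b (∣-trans d∣g (gcd[m,n]∣m a c) , d∣b)
  a′gb≡[c′g]² : a′ * g * b ≡ c′ * g * (c′ * g)
  a′gb≡[c′g]² = subst₂ (λ x y → x * b ≡ y * y) a≡a′g c≡c′g ab≡c²

private
  p-divisor-part : ∀ {p a b w} .{{_ : NonZero p}} → p ∣ a → Coprime a b → a * b ≡ p * (w * w) →
    ∃[ r ] ∃[ s ] a ≡ p * (r * r) × b ≡ s * s
  p-divisor-part {p} {b = b} {w} (divides C refl) Cp⊥b Cpb≡pw² =
    let r , C≡r² = coprime-product-square {c = w} C⊥b Cb≡w²
        s , b≡s² = coprime-product-square {c = w} (Coprime.sym C⊥b) (trans (*-comm b C) Cb≡w²)
    in  r , s , trans (*-comm C p) (cong (p *_) C≡r²) , b≡s²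
    where
    C⊥b : Coprime C b
    C⊥b (d∣C , d∣b) = Cp⊥b (∣-trans d∣C (m∣m*n p) , d∣b)
    Cb≡w² : C * b ≡ w * w
    Cb≡w² = *-cancelˡ-≡ _ _ p (begin
      p * (C * b)   ≡⟨ solve (p ∷ C ∷ b ∷ []) ⟩
      C * p * b     ≡⟨ Cpb≡pw² ⟩
      p * (w * w)   ∎)
      where open ≡-Reasoning

coprime-product-p-square : ∀ {p a b w} → Prime p → Coprime a b → a * b ≡ p * (w * w) →
  (∃[ r ] ∃[ s ] a ≡ p * (r * r) × b ≡ s * s) ⊎ (∃[ r ] ∃[ s ] a ≡ s * s × b ≡ p * (r * r))
coprime-product-p-square {p} {a} {b} {w} p-prime a⊥b ab≡pw²
  with euclidsLemma a b p-prime (divides (w * w) (trans ab≡pw² (*-comm p _)))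
... | inj₁ p∣a = inj₁ (p-divisor-part {w = w} {{prime⇒nonZero p-prime}} p∣a a⊥b ab≡pw²)
... | inj₂ p∣b =
  let r , s , b≡pr² , a≡s² = p-divisor-part {w = w} {{prime⇒nonZero p-prime}} p∣b
                               (Coprime.sym a⊥b) (trans (*-comm b a) ab≡pw²)
  in  inj₂ (r , s , a≡s² , b≡pr²)

±2Solution : ℕ → Set
±2Solution p = ∃[ s ] ∃[ j ] ∃[ k ] 0 < k × NormEq p s j k 2

even-square%4 : ∀ a → 2 * a * (2 * a) % 4 ≡ 0
even-square%4 a = trans (cong (_% 4) [2a]²≡a²*4) (m*n%n≡0 (a * a) 4)
  where
  [2a]²≡a²*4 : 2 * a * (2 * a) ≡ a * a * 4
  [2a]²≡a²*4 = solve (a ∷ [])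

odd-square%4 : ∀ a → (1 + 2 * a) * (1 + 2 * a) % 4 ≡ 1
odd-square%4 a = trans (cong (_% 4) [1+2a]²≡1+[a²+a]*4) ([m+kn]%n≡m%n 1 (a * a + a) 4)
  where
  [1+2a]²≡1+[a²+a]*4 : (1 + 2 * a) * (1 + 2 * a) ≡ 1 + (a * a + a) * 4
  [1+2a]²≡1+[a²+a]*4 = solve (a ∷ [])

square%4 : ∀ r → r * r % 4 ≡ 0 ⊎ r * r % 4 ≡ 1
square%4 r with evenOrOdd r
... | even a = inj₁ (even-square%4 a)
... | odd a  = inj₂ (odd-square%4 a)

positive-square-factor : ∀ {n} c r → 0 < n → n ≡ c * (r * r) → 0 < r
positive-square-factor c zero    0<n n≡0 = contradiction (trans n≡0 (*-zeroʳ c)) (>⇒≢ 0<n)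
positive-square-factor c (suc r) _   _   = z<s

module Descent {p} (p-prime : Prime p) (p%4≡3 : p % 4 ≡ 3) where

  instance
    p≢0 : NonZero p
    p≢0 = prime⇒nonZero p-prime

  p*%4 : ∀ {x r} → x % 4 ≡ r → p * x % 4 ≡ 3 * r % 4
  p*%4 {x} x%4≡r = trans (%-distribˡ-* p x 4) (cong₂ (λ a b → a * b % 4) p%4≡3 x%4≡r)

  p*square%4 : ∀ r → p * (r * r) % 4 ≡ 0 ⊎ p * (r * r) % 4 ≡ 3
  p*square%4 r with square%4 r
  ... | inj₁ r²%4≡0 = inj₁ (p*%4 r²%4≡0)
  ... | inj₂ r²%4≡1 = inj₂ (p*%4 r²%4≡1)

  p*square≢square+1 : ∀ r s → p * (r * r) ≢ s * s + 1
  p*square≢square+1 r s eq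
    with p * (r * r) % 4 | p*square%4 r | s * s % 4 | square%4 s | trans (cong (_% 4) eq) (%-distribˡ-+ (s * s) 1 4)
  ... | _ | inj₁ refl | _ | inj₁ refl | ()
  ... | _ | inj₁ refl | _ | inj₂ refl | ()
  ... | _ | inj₂ refl | _ | inj₁ refl | ()
  ... | _ | inj₂ refl | _ | inj₂ refl | ()

  odd-p*square≢4* : ∀ a x → p * ((1 + 2 * a) * (1 + 2 * a)) ≢ 4 * x
  odd-p*square≢4* a x eq
    with trans (sym (p*%4 (odd-square%4 a)))
               (trans (cong (_% 4) eq) (trans (cong (_% 4) (*-comm 4 x)) (m*n%n≡0 x 4)))
  ... | ()

  0<p*square : ∀ {w} → 0 < w → 0 < p * (w * w)
  0<p*square 0<w = *-mono-≤ (>-nonZero⁻¹ p) (*-mono-≤ 0<w 0<w)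

  ±2-from-even-pell : ∀ a {V} → 2 * a * (2 * a) ≡ p * (V * V) + 1 → ±2Solution p
  ±2-from-even-pell zero    eq = contradiction (trans eq (+-comm _ 1)) 0≢1+n
  ±2-from-even-pell (suc a) {V} eq
    with coprime-product-p-square {w = V} p-prime (odd-coprime-+2 a)
           (+-cancelʳ-≡ 1 _ _ (trans [D*[D+2]]+1≡U² eq))
    where
    [D*[D+2]]+1≡U² : (1 + 2 * a) * (1 + 2 * a + 2) + 1 ≡ 2 * suc a * (2 * suc a)
    [D*[D+2]]+1≡U² = solve (a ∷ [])
  ... | inj₁ (r , s , D≡pr² , D+2≡s²) =
    Sign.+ , s , r , positive-square-factor p r z<s D≡pr² , trans (sym D+2≡s²) (cong (_+ 2) D≡pr²)
  ... | inj₂ (r , s , D≡s² , D+2≡pr²) =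
    Sign.- , s , r , positive-square-factor {1 + 2 * a + 2} p r z<s D+2≡pr² ,
    trans (sym D+2≡pr²) (cong (_+ 2) D≡s²)

  PellDescends : ℕ → Set
  PellDescends U = ∀ {V} → 0 < V → NormEq p Sign.+ U V 1 → ±2Solution p

  ±2-from-odd-pell : ∀ a → (∀ {U} → U < 1 + 2 * a → PellDescends U) → PellDescends (1 + 2 * a)
  ±2-from-odd-pell a rec {V} 0<V eq with evenOrOdd V | +-cancelʳ-≡ 1 _ _ (trans (sym eq) [1+2a]²≡4a[a+1]+1)
    where
    [1+2a]²≡4a[a+1]+1 : (1 + 2 * a) * (1 + 2 * a) ≡ 4 * (a * (a + 1)) + 1
    [1+2a]²≡4a[a+1]+1 = solve (a ∷ [])
  ... | odd w  | pV²≡4a[a+1] = contradiction pV²≡4a[a+1] (odd-p*square≢4* w (a * (a + 1)))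
  ... | even w | p[2w]²≡4a[a+1]
    with coprime-product-p-square {w = w} p-prime (coprime-consecutive a) a[a+1]≡pw²
    where
    a[a+1]≡pw² : a * (a + 1) ≡ p * (w * w)
    a[a+1]≡pw² = *-cancelˡ-≡ _ _ 4 (begin
      4 * (a * (a + 1))     ≡⟨ p[2w]²≡4a[a+1] ⟨
      p * (2 * w * (2 * w)) ≡⟨ solve (p ∷ w ∷ []) ⟩
      4 * (p * (w * w))     ∎)
      where open ≡-Reasoning
  ...   | inj₂ (r , s , a≡s² , a+1≡pr²) =
    contradiction (trans (sym a+1≡pr²) (cong (_+ 1) a≡s²)) (p*square≢square+1 r s)
  ...   | inj₁ (r , s , a≡pr² , a+1≡s²) =
    rec s<1+2a (positive-square-factor p r 0<a a≡pr²) (trans (sym a+1≡s²) (cong (_+ 1) a≡pr²))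
    where
    0<a : 0 < a
    0<a = n≢0⇒n>0 λ a≡0 → >⇒≢ (0<p*square 0<V) (trans p[2w]²≡4a[a+1] (cong (λ t → 4 * (t * (t + 1))) a≡0))
    s<1+2a : s < 1 + 2 * a
    s<1+2a = m*m<n*n⇒m<n (begin-strict
      s * s                        ≡⟨ a+1≡s² ⟨
      a + 1                        ≡⟨ +-comm a 1 ⟩
      1 + a                        <⟨ +-monoʳ-< 1 (m<m+n a 0<a) ⟩
      1 + (a + a)                  ≡⟨ solve (a ∷ []) ⟩
      1 + 2 * a                    ≤⟨ m≤m*n (1 + 2 * a) (1 + 2 * a) ⟩
      (1 + 2 * a) * (1 + 2 * a)    ∎)
      where open ≤-Reasoning

  ±2-from-pell : ∀ U → PellDescends U
  ±2-from-pell = <-rec PellDescends descend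
    where
    descend : ∀ U → (∀ {U′} → U′ < U → PellDescends U′) → PellDescends U
    descend U rec {V} 0<V eq with evenOrOdd U
    ... | even a = ±2-from-even-pell a {V} eq
    ... | odd a  = ±2-from-odd-pell a rec 0<V eq

  even-±2-root-impossible : ∀ s w {k} → ¬ NormEq p s (2 * w) k 2
  even-±2-root-impossible Sign.+ w {k} eq
    with p * (k * k) % 4 | p*square%4 k
       | trans (sym (even-square%4 w)) (trans (cong (_% 4) eq) (%-distribˡ-+ (p * (k * k)) 2 4))
  ... | _ | inj₁ refl | ()
  ... | _ | inj₂ refl | ()
  even-±2-root-impossible Sign.- w {k} eq
    with p * (k * k) % 4 | p*square%4 k
       | trans (cong (_% 4) eq)
           (trans (%-distribˡ-+ (2 * w * (2 * w)) 2 4) (cong (λ t → (t + 2) % 4) (even-square%4 w)))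
  ... | _ | inj₁ refl | ()
  ... | _ | inj₂ refl | ()

  ±2-root-odd : ∀ s {j k} → NormEq p s j k 2 → ∃[ w ] j ≡ 1 + 2 * w
  ±2-root-odd s {j} eq with evenOrOdd j
  ... | odd w  = w , refl
  ... | even w = contradiction eq (even-±2-root-impossible s w)

-- Powers of rationals

^ℚ≡^ : ∀ x n → x ^ℚ n ≡ x Exp.^ n
^ℚ≡^ x zero    = refl
^ℚ≡^ x (suc n) = cong (x ℚ.*_) (^ℚ≡^ x n)

^ℚ-assoc : ∀ x m n → (x ^ℚ m) ^ℚ n ≡ x ^ℚ (m * n)
^ℚ-assoc x m n = begin
  (x ^ℚ m) ^ℚ n        ≡⟨ ^ℚ≡^ (x ^ℚ m) n ⟩
  (x ^ℚ m) Exp.^ n     ≡⟨ cong (Exp._^ n) (^ℚ≡^ x m) ⟩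
  (x Exp.^ m) Exp.^ n  ≡⟨ Exp.^-assocʳ x m n ⟩
  x Exp.^ (m * n)      ≡⟨ ^ℚ≡^ x (m * n) ⟨
  x ^ℚ (m * n)         ∎
  where open ≡-Reasoning

-- x = n / d, not necessarily in lowest terms
record IsRatio (x : ℚ) (n d : ℕ) : Set where
  constructor isRatio
  field
    cross-multiplied : ↥ x ℤ.* + d ≡ + n ℤ.* ↧ x

↥*-↧* : ∀ x y → ↥ (x ℚ.* y) ℤ.* (↧ x ℤ.* ↧ y) ≡ (↥ x ℤ.* ↥ y) ℤ.* ↧ (x ℚ.* y)
↥*-↧* x@(mkℚ _ dx _) y@(mkℚ _ dy _) with ℚ.toℚᵘ-homo-* x y
... | ℚᵘ.*≡* eq = begin
  ↥ (x ℚ.* y) ℤ.* (↧ x ℤ.* ↧ y)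
    ≡⟨ cong₂ ℤ._*_ (ℚ.↥ᵘ-toℚᵘ (x ℚ.* y)) (ℤ.pos-* (suc dx) (suc dy)) ⟨
  ℚᵘ.↥ (ℚ.toℚᵘ (x ℚ.* y)) ℤ.* + (suc dx * suc dy)
    ≡⟨ eq ⟩
  (↥ x ℤ.* ↥ y) ℤ.* ℚᵘ.↧ (ℚ.toℚᵘ (x ℚ.* y))
    ≡⟨ cong (ℤ._*_ (↥ x ℤ.* ↥ y)) (ℚ.↧ᵘ-toℚᵘ (x ℚ.* y)) ⟩
  (↥ x ℤ.* ↥ y) ℤ.* ↧ (x ℚ.* y)
    ∎
  where open ≡-Reasoning

isRatio-/ : ∀ n d .{{_ : NonZero d}} → IsRatio (+ n ℚ./ d) n d
isRatio-/ n d = isRatio (begin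
  ↥ q ℤ.* + d                          ≡⟨ cong (ℤ._*_ (↥ q)) (ℚ.↧-/ (+ n) d) ⟨
  ↥ q ℤ.* (↧ q ℤ.* gcdℤ (+ n) (+ d))  ≡⟨ ℤ*.x∙yz≈xz∙y (↥ q) (↧ q) _ ⟩
  ↥ q ℤ.* gcdℤ (+ n) (+ d) ℤ.* ↧ q    ≡⟨ cong (ℤ._* ↧ q) (ℚ.↥-/ (+ n) d) ⟩
  + n ℤ.* ↧ q                          ∎)
  where
  open ≡-Reasoning
  q : ℚ
  q = + n ℚ./ d

isRatio-* : ∀ {x y n m d e} → IsRatio x n d → IsRatio y m e → IsRatio (x ℚ.* y) (n * m) (d * e)
isRatio-* {x@(mkℚ _ _ _)} {y@(mkℚ _ _ _)} {n} {m} {d} {e} (isRatio x≐n/d) (isRatio y≐m/e) =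
  isRatio (ℤ.*-cancelʳ-≡ _ _ (↧ x ℤ.* ↧ y) (begin
    ↥ (x ℚ.* y) ℤ.* + (d * e) ℤ.* (↧ x ℤ.* ↧ y)            ≡⟨ ℤ*.xy∙z≈xz∙y (↥ (x ℚ.* y)) _ _ ⟩
    ↥ (x ℚ.* y) ℤ.* (↧ x ℤ.* ↧ y) ℤ.* + (d * e)            ≡⟨ cong₂ ℤ._*_ (↥*-↧* x y) (ℤ.pos-* d e) ⟩
    ↥ x ℤ.* ↥ y ℤ.* ↧ (x ℚ.* y) ℤ.* (+ d ℤ.* + e)          ≡⟨ ℤ*.xy∙z≈xz∙y (↥ x ℤ.* ↥ y) _ _ ⟩
    ↥ x ℤ.* ↥ y ℤ.* (+ d ℤ.* + e) ℤ.* ↧ (x ℚ.* y)          ≡⟨ cong (ℤ._* ↧ (x ℚ.* y)) (ℤ*.interchange (↥ x) _ _ _) ⟩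
    ↥ x ℤ.* + d ℤ.* (↥ y ℤ.* + e) ℤ.* ↧ (x ℚ.* y)          ≡⟨ cong₂ (λ s t → s ℤ.* t ℤ.* ↧ (x ℚ.* y)) x≐n/d y≐m/e ⟩
    + n ℤ.* ↧ x ℤ.* (+ m ℤ.* ↧ y) ℤ.* ↧ (x ℚ.* y)          ≡⟨ cong (ℤ._* ↧ (x ℚ.* y)) (ℤ*.interchange (+ n) _ _ _) ⟩
    + n ℤ.* + m ℤ.* (↧ x ℤ.* ↧ y) ℤ.* ↧ (x ℚ.* y)          ≡⟨ ℤ*.xy∙z≈xz∙y (+ n ℤ.* + m) _ _ ⟩
    + n ℤ.* + m ℤ.* ↧ (x ℚ.* y) ℤ.* (↧ x ℤ.* ↧ y)
      ≡⟨ cong (λ t → t ℤ.* ↧ (x ℚ.* y) ℤ.* (↧ x ℤ.* ↧ y)) (ℤ.pos-* n m) ⟨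
    + (n * m) ℤ.* ↧ (x ℚ.* y) ℤ.* (↧ x ℤ.* ↧ y)            ∎))
  where open ≡-Reasoning

isRatio-^ : ∀ {x n d} → IsRatio x n d → ∀ k → IsRatio (x ^ℚ k) (n ^ k) (d ^ k)
isRatio-^ x≐n/d zero    = isRatio refl
isRatio-^ x≐n/d (suc k) = isRatio-* x≐n/d (isRatio-^ x≐n/d k)

isRatio-cross : ∀ {x n d n′ d′} → IsRatio x n d → IsRatio x n′ d′ → n * d′ ≡ n′ * d
isRatio-cross {x@(mkℚ _ _ _)} {n} {d} {n′} {d′} (isRatio x≐n/d) (isRatio x≐n′/d′) =
  ℤ.+-injective (ℤ.*-cancelʳ-≡ _ _ (↧ x) (begin
    + (n * d′) ℤ.* ↧ x       ≡⟨ cong (ℤ._* ↧ x) (ℤ.pos-* n d′) ⟩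
    + n ℤ.* + d′ ℤ.* ↧ x     ≡⟨ ℤ*.xy∙z≈xz∙y (+ n) (+ d′) (↧ x) ⟩
    + n ℤ.* ↧ x ℤ.* + d′     ≡⟨ cong (ℤ._* + d′) x≐n/d ⟨
    ↥ x ℤ.* + d ℤ.* + d′     ≡⟨ ℤ*.xy∙z≈xz∙y (↥ x) (+ d) (+ d′) ⟩
    ↥ x ℤ.* + d′ ℤ.* + d     ≡⟨ cong (ℤ._* + d) x≐n′/d′ ⟩
    + n′ ℤ.* ↧ x ℤ.* + d     ≡⟨ ℤ*.xy∙z≈xz∙y (+ n′) (↧ x) (+ d) ⟩
    + n′ ℤ.* + d ℤ.* ↧ x     ≡⟨ cong (ℤ._* ↧ x) (ℤ.pos-* n′ d) ⟨
    + (n′ * d) ℤ.* ↧ x       ∎))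
  where open ≡-Reasoning

isRatio-unique : ∀ {x y n d} .{{_ : NonZero d}} → IsRatio x n d → IsRatio y n d → x ≡ y
isRatio-unique {x} {y} {n} {d} (isRatio x≐n/d) (isRatio y≐n/d) =
  ℚ.≃⇒≡ (ℚ.*≡* (ℤ.*-cancelʳ-≡ _ _ (+ d) (begin
  ↥ x ℤ.* ↧ y ℤ.* + d     ≡⟨ ℤ*.xy∙z≈xz∙y (↥ x) (↧ y) (+ d) ⟩
  ↥ x ℤ.* + d ℤ.* ↧ y     ≡⟨ cong (ℤ._* ↧ y) x≐n/d ⟩
  + n ℤ.* ↧ x ℤ.* ↧ y     ≡⟨ ℤ*.xy∙z≈xz∙y (+ n) (↧ x) (↧ y) ⟩
  + n ℤ.* ↧ y ℤ.* ↧ x     ≡⟨ cong (ℤ._* ↧ x) y≐n/d ⟨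
  ↥ y ℤ.* + d ℤ.* ↧ x     ≡⟨ ℤ*.xy∙z≈xz∙y (↥ y) (+ d) (↧ x) ⟩
  ↥ y ℤ.* ↧ x ℤ.* + d     ∎)))
  where open ≡-Reasoning

isRatio-pos : ∀ {x n d} .{{_ : NonZero n}} .{{_ : NonZero d}} → IsRatio x n d → 0ℚ ℚ.< x
isRatio-pos {x} {n} {d} x≐n/d =
  subst (0ℚ ℚ.<_) (isRatio-unique (isRatio-/ n d) x≐n/d) (ℚ.positive⁻¹ _ {{ℚ.normalize-pos n d}})

isRatio-self : ∀ x → 0ℚ ℚ.< x → IsRatio x ℤ.∣ ↥ x ∣ (↧ₙ x)
isRatio-self (mkℚ (+ _)      _ _) _ = isRatio refl
isRatio-self (mkℚ -[1+ _ ] _ _) (ℚ.*<* ())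

^-injectiveˡ : ∀ {k m n} → 0 < k → m ^ k ≡ n ^ k → m ≡ n
^-injectiveˡ {k} {m} {n} 0<k mᵏ≡nᵏ with <-cmp m n
... | tri< m<n _ _ = contradiction mᵏ≡nᵏ (<⇒≢ (^-monoˡ-< k {{>-nonZero 0<k}} m<n))
... | tri≈ _ m≡n _ = m≡n
... | tri> _ _ n<m = contradiction (sym mᵏ≡nᵏ) (<⇒≢ (^-monoˡ-< k {{>-nonZero 0<k}} n<m))

-- The exponents of PowEq x y y (p x), so that y / (p x) = exponentˣ / exponentʸ.
exponentˣ exponentʸ : ℕ → ℚ × ℚ → ℕ
exponentˣ p (x , y) = ℤ.∣ ↥ y ∣ * ↧ₙ (ℕtoℚ p ℚ.* x)
exponentʸ p (x , y) = ℤ.∣ ↥ (ℕtoℚ p ℚ.* x) ∣ * ↧ₙ y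

private
  ratio-balance : ∀ {a b Yn Yd Vn Vd Ny Dy Nv Dv} .{{_ : NonZero (Dy * Dv)}} →
    Yn * Dy ≡ Ny * Yd → Vn * Dv ≡ Nv * Vd → b * (Ny * Dv) ≡ a * (Nv * Dy) →
    b * (Yn * Vd) ≡ a * (Vn * Yd)
  ratio-balance {a} {b} {Yn} {Yd} {Vn} {Vd} {Ny} {Dy} {Nv} {Dv} y≐ v≐ balanced =
    *-cancelʳ-≡ _ _ (Dy * Dv) (begin
      b * (Yn * Vd) * (Dy * Dv)    ≡⟨ solve (b ∷ Yn ∷ Vd ∷ Dy ∷ Dv ∷ []) ⟩
      b * (Yn * Dy) * (Vd * Dv)    ≡⟨ cong (λ t → b * t * (Vd * Dv)) y≐ ⟩
      b * (Ny * Yd) * (Vd * Dv)    ≡⟨ solve (b ∷ Ny ∷ Yd ∷ Vd ∷ Dv ∷ []) ⟩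
      b * (Ny * Dv) * (Yd * Vd)    ≡⟨ cong (_* (Yd * Vd)) balanced ⟩
      a * (Nv * Dy) * (Yd * Vd)    ≡⟨ solve (a ∷ Nv ∷ Dy ∷ Yd ∷ Vd ∷ []) ⟩
      a * (Nv * Vd) * (Yd * Dy)    ≡⟨ cong (λ t → a * t * (Yd * Dy)) v≐ ⟨
      a * (Vn * Dv) * (Yd * Dy)    ≡⟨ solve (a ∷ Vn ∷ Dv ∷ Yd ∷ Dy ∷ []) ⟩
      a * (Vn * Yd) * (Dy * Dv)    ∎)
    where open ≡-Reasoning

powerPoint : (c d a b : ℕ) .{{_ : NonZero d}} → ℚ × ℚ
powerPoint c d a b = (+ c ℚ./ d) ^ℚ b , (+ c ℚ./ d) ^ℚ a

0<∣↥∣ : ∀ x → 0ℚ ℚ.< x → 0 < ℤ.∣ ↥ x ∣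
0<∣↥∣ (mkℚ (+ zero)    _ _) (ℚ.*<* (ℤ.+<+ ()))
0<∣↥∣ (mkℚ (+ suc _)   _ _) _ = z<s
0<∣↥∣ (mkℚ -[1+ _ ]    _ _) (ℚ.*<* ())

-- With r = c / d, the point (r^b, r^a) has y = x^(a/b), and x^y = y^(p x) comes down
-- to b y = a p x, which is `balanced` multiplied out.
module PowerPoint (p c d a b : ℕ) .{{_ : NonZero p}} .{{_ : NonZero c}} .{{_ : NonZero d}}
                  (c≢d : c ≢ d) (0<a : 0 < a) (0<b : 0 < b)
                  (balanced : b * (c ^ a * d ^ b) ≡ a * (p * c ^ b * d ^ a)) where

  r x y : ℚ
  r = + c ℚ./ d
  x = r ^ℚ b
  y = r ^ℚ a

  private
    instance
      cᵃ≢0 : NonZero (c ^ a)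
      cᵃ≢0 = m^n≢0 c a
      cᵇ≢0 : NonZero (c ^ b)
      cᵇ≢0 = m^n≢0 c b
      dᵃ≢0 : NonZero (d ^ a)
      dᵃ≢0 = m^n≢0 d a
      dᵇ≢0 : NonZero (d ^ b)
      dᵇ≢0 = m^n≢0 d b
      pcᵇ≢0 : NonZero (p * c ^ b)
      pcᵇ≢0 = m*n≢0 p (c ^ b)
      dᵃdᵇ≢0 : NonZero (d ^ a * d ^ b)
      dᵃdᵇ≢0 = m*n≢0 (d ^ a) (d ^ b)

    x≐ : IsRatio x (c ^ b) (d ^ b)
    x≐ = isRatio-^ (isRatio-/ c d) b
    y≐ : IsRatio y (c ^ a) (d ^ a)
    y≐ = isRatio-^ (isRatio-/ c d) a
    px≐ : IsRatio (ℕtoℚ p ℚ.* x) (p * c ^ b) (d ^ b)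
    px≐ = subst (IsRatio (ℕtoℚ p ℚ.* x) (p * c ^ b)) (*-identityˡ (d ^ b)) (isRatio-* (isRatio-/ p 1) x≐)

    ≢1 : ∀ {z k} → 0 < k → IsRatio z (c ^ k) (d ^ k) → z ≢ 1ℚ
    ≢1 {k = k} 0<k z≐ refl = c≢d (^-injectiveˡ 0<k (begin
      c ^ k       ≡⟨ *-identityʳ (c ^ k) ⟨
      c ^ k * 1   ≡⟨ isRatio-cross {n′ = 1} {d′ = 1} z≐ (isRatio refl) ⟩
      1 * d ^ k   ≡⟨ *-identityˡ (d ^ k) ⟩
      d ^ k       ∎))
      where open ≡-Reasoning

  0<x : 0ℚ ℚ.< x
  0<x = isRatio-pos x≐

  0<y : 0ℚ ℚ.< y
  0<y = isRatio-pos y≐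

  x≢1 : x ≢ 1ℚ
  x≢1 = ≢1 0<b x≐

  y≢1 : y ≢ 1ℚ
  y≢1 = ≢1 0<a y≐

  exponent-balance : b * exponentˣ p (x , y) ≡ a * exponentʸ p (x , y)
  exponent-balance = ratio-balance {a} {b} {ℤ.∣ ↥ y ∣} {↧ₙ y} {ℤ.∣ ↥ (ℕtoℚ p ℚ.* x) ∣} {↧ₙ (ℕtoℚ p ℚ.* x)}
    {c ^ a} {d ^ a} {p * c ^ b} {d ^ b} (isRatio-cross (isRatio-self y 0<y) y≐)
    (isRatio-cross (isRatio-self _ (isRatio-pos px≐)) px≐) balanced

  powEq : PowEq x y y (ℕtoℚ p ℚ.* x)
  powEq = begin
    x ^ℚ exponentˣ p (x , y)       ≡⟨ ^ℚ-assoc r b _ ⟩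
    r ^ℚ (b * exponentˣ p (x , y)) ≡⟨ cong (r ^ℚ_) exponent-balance ⟩
    r ^ℚ (a * exponentʸ p (x , y)) ≡⟨ ^ℚ-assoc r a _ ⟨
    y ^ℚ exponentʸ p (x , y)       ∎
    where open ≡-Reasoning

  0<exponentʸ : 0 < exponentʸ p (x , y)
  0<exponentʸ = *-mono-≤ (0<∣↥∣ _ (isRatio-pos px≐)) z<s

  yᵇ≡xᵃ : y ^ℚ b ≡ x ^ℚ a
  yᵇ≡xᵃ = trans (^ℚ-assoc r a b) (trans (cong (r ^ℚ_) (*-comm a b)) (sym (^ℚ-assoc r b a)))

-- Infinitely many points of S₂(p)

injective-escapes : ∀ {A : Set} → DecidableEquality A → (f : ℕ → A) → Injective _≡_ _≡_ f →
  (L : List A) → ∃[ n ] f n ∉ L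
injective-escapes _≟_ f f-inj [] = 0 , λ ()
injective-escapes _≟_ f f-inj (z ∷ L) with injective-escapes _≟_ f f-inj L
... | n , fn∉L with f n ≟ z
...   | no fn≢z = n , λ { (here fn≡z) → fn≢z fn≡z ; (there fn∈L) → fn∉L fn∈L }
...   | yes fn≡z with injective-escapes _≟_ (f ∘ (_+ suc n)) (+-cancelʳ-≡ (suc n) _ _ ∘ f-inj) L
...     | m , f[m+1+n]∉L = m + suc n , λ
  { (here f[m+1+n]≡z) → m+1+n≢n m (f-inj (trans f[m+1+n]≡z (sym fn≡z)))
  ; (there f[m+1+n]∈L) → f[m+1+n]∉L f[m+1+n]∈L }

coprime-±2 : ∀ {a b w} → a ≡ b + 2 ⊎ b ≡ a + 2 → a ≡ 1 + 2 * w → Coprime a b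
coprime-±2 {w = w} (inj₂ refl) refl = odd-coprime-+2 w
coprime-±2 {b = b} {zero} (inj₁ a≡b+2) refl = contradiction (trans (+-comm 2 b) (sym a≡b+2)) λ ()
coprime-±2 {b = b} {suc w} (inj₁ a≡b+2) refl =
  subst (Coprime (1 + 2 * suc w)) (sym b≡1+2w)
    (subst (λ m → Coprime m (1 + 2 * w)) 1+2w+2≡a (Coprime.sym (odd-coprime-+2 w)))
  where
  1+2w+2≡a : 1 + 2 * w + 2 ≡ 1 + 2 * suc w
  1+2w+2≡a = solve (w ∷ [])
  b≡1+2w : b ≡ 1 + 2 * w
  b≡1+2w = +-cancelʳ-≡ 2 b _ (trans (sym a≡b+2) (sym 1+2w+2≡a))

balanced-above : ∀ p j k → j * j ≡ p * (k * k) + 2 →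
  p * (k * k) * (j ^ (j * j) * k ^ (p * (k * k))) ≡ j * j * (p * j ^ (p * (k * k)) * k ^ (j * j))
balanced-above p j k a≡b+2 = begin
  b * (j ^ (j * j) * k ^ b)              ≡⟨ cong (λ e → b * (j ^ e * k ^ b)) a≡b+2 ⟩
  b * (j ^ (b + 2) * k ^ b)              ≡⟨ cong (λ t → b * (t * k ^ b)) (^-distribˡ-+-* j b 2) ⟩
  b * (j ^ b * j ^ 2 * k ^ b)            ≡⟨ regroup p j k (j ^ b) (k ^ b) ⟩
  j * j * (p * j ^ b * (k ^ b * k ^ 2))  ≡⟨ cong (λ t → j * j * (p * j ^ b * t)) (^-distribˡ-+-* k b 2) ⟨
  j * j * (p * j ^ b * k ^ (b + 2))      ≡⟨ cong (λ e → j * j * (p * j ^ b * k ^ e)) a≡b+2 ⟨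
  j * j * (p * j ^ b * k ^ (j * j))      ∎
  where
  open ≡-Reasoning
  b : ℕ
  b = p * (k * k)
  regroup : ∀ p j k J K → p * (k * k) * (J * (j * (j * 1)) * K) ≡ j * j * (p * J * (K * (k * (k * 1))))
  regroup = solve-∀

balanced-below : ∀ p j k → p * (k * k) ≡ j * j + 2 →
  p * (k * k) * (k ^ (j * j) * j ^ (p * (k * k))) ≡ j * j * (p * k ^ (p * (k * k)) * j ^ (j * j))
balanced-below p j k b≡a+2 = begin
  p * (k * k) * (k ^ a * j ^ (p * (k * k)))  ≡⟨ cong (λ e → p * (k * k) * (k ^ a * j ^ e)) b≡a+2 ⟩
  p * (k * k) * (k ^ a * j ^ (a + 2))        ≡⟨ cong (λ t → p * (k * k) * (k ^ a * t)) (^-distribˡ-+-* j a 2) ⟩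
  p * (k * k) * (k ^ a * (j ^ a * j ^ 2))    ≡⟨ regroup p j k (k ^ a) (j ^ a) ⟩
  a * (p * (k ^ a * k ^ 2) * j ^ a)          ≡⟨ cong (λ t → a * (p * t * j ^ a)) (^-distribˡ-+-* k a 2) ⟨
  a * (p * k ^ (a + 2) * j ^ a)              ≡⟨ cong (λ e → a * (p * k ^ e * j ^ a)) b≡a+2 ⟨
  a * (p * k ^ (p * (k * k)) * j ^ a)        ∎
  where
  open ≡-Reasoning
  a : ℕ
  a = j * j
  regroup : ∀ p j k K J → p * (k * k) * (K * (J * (j * (j * 1)))) ≡ j * j * (p * (K * (k * (k * 1))) * J)
  regroup = solve-∀

ratio-determined : ∀ {a b a′ b′ X Z} .{{_ : NonZero Z}} → b * X ≡ a * Z → b′ * X ≡ a′ * Z → a * b′ ≡ a′ * b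
ratio-determined {a} {b} {a′} {b′} {X} {Z} bX≡aZ b′X≡a′Z = *-cancelʳ-≡ _ _ Z (begin
  a * b′ * Z     ≡⟨ solve (a ∷ b′ ∷ Z ∷ []) ⟩
  b′ * (a * Z)   ≡⟨ cong (b′ *_) bX≡aZ ⟨
  b′ * (b * X)   ≡⟨ solve (b′ ∷ b ∷ X ∷ []) ⟩
  b * (b′ * X)   ≡⟨ cong (b *_) b′X≡a′Z ⟩
  b * (a′ * Z)   ≡⟨ solve (b ∷ a′ ∷ Z ∷ []) ⟩
  a′ * b * Z     ∎)
  where open ≡-Reasoning

+2-cross-injective : ∀ {b b′} → (b + 2) * b′ ≡ (b′ + 2) * b → b ≡ b′
+2-cross-injective {b} {b′} eq = sym (*-cancelˡ-≡ _ _ 2 (+-cancelˡ-≡ (b * b′) _ _ (begin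
  b * b′ + 2 * b′   ≡⟨ solve (b ∷ b′ ∷ []) ⟩
  (b + 2) * b′      ≡⟨ eq ⟩
  (b′ + 2) * b      ≡⟨ solve (b ∷ b′ ∷ []) ⟩
  b * b′ + 2 * b    ∎)))
  where open ≡-Reasoning

square-of-odd : ∀ w → (1 + 2 * w) * (1 + 2 * w) ≡ 1 + 2 * (2 * (w * w + w))
square-of-odd w = solve (w ∷ [])

module PointSequence {p} (p-prime : Prime p) (p%4≡3 : p % 4 ≡ 3) where

  open Descent p-prime p%4≡3
  open PellExistence {p} (prime⇒nonSquare p-prime) using (pell)
  open ≤-Reasoning

  3≤p : 3 ≤ p
  3≤p = subst (_≤ p) p%4≡3 (m%n≤m p 4)

  -- a = j², b = p k² and r = (j/k)^(±1), so that r^(a - b) = (j/k)² = p a / b.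
  ±2-point : Sign → (j k : ℕ) .{{_ : NonZero j}} .{{_ : NonZero k}} → ℚ × ℚ
  ±2-point Sign.+ j k = powerPoint j k (j * j) (p * (k * k))
  ±2-point Sign.- j k = powerPoint k j (j * j) (p * (k * k))

  module _ {j k : ℕ} .{{_ : NonZero j}} .{{_ : NonZero k}} (2≤k : 2 ≤ k) where

    private
      0<a : 0 < j * j
      0<a = >-nonZero⁻¹ (j * j) {{m*n≢0 j j}}
      0<b : 0 < p * (k * k)
      0<b = 0<p*square (>-nonZero⁻¹ k)

      j≢k : j * j ≡ p * (k * k) + 2 → j ≢ k
      j≢k a≡b+2 j≡k = <⇒≢ (begin-strict
        k * k             ≤⟨ m≤n*m (k * k) p ⟩
        p * (k * k)       <⟨ m<m+n _ z<s ⟩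
        p * (k * k) + 2   ∎) (subst (λ t → t * t ≡ p * (k * k) + 2) j≡k a≡b+2)

      k≢j : p * (k * k) ≡ j * j + 2 → k ≢ j
      k≢j b≡a+2 k≡j = <⇒≢ (begin-strict
        k * k + 2            <⟨ +-monoʳ-< (k * k) (≤-trans 3≤8 (*-monoʳ-≤ 2 (*-mono-≤ 2≤k 2≤k))) ⟩
        k * k + 2 * (k * k)  ≡⟨ solve (k ∷ []) ⟩
        3 * (k * k)          ≤⟨ *-monoˡ-≤ (k * k) 3≤p ⟩
        p * (k * k)          ∎) (sym (subst (λ t → p * (k * k) ≡ t * t + 2) (sym k≡j) b≡a+2))
        where
        3≤8 : 3 ≤ 2 * (2 * 2)
        3≤8 = s≤s (s≤s (s≤s z≤n))

    module Point₊ (a≡b+2 : j * j ≡ p * (k * k) + 2) =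
      PowerPoint p j k (j * j) (p * (k * k)) (j≢k a≡b+2) 0<a 0<b (balanced-above p j k a≡b+2)
    module Point₋ (b≡a+2 : p * (k * k) ≡ j * j + 2) =
      PowerPoint p k j (j * j) (p * (k * k)) (k≢j b≡a+2) 0<a 0<b (balanced-below p j k b≡a+2)

    ±2-point-∈S₂ : ∀ s → NormEq p s j k 2 → S₂ p (±2-point s j k)
    ±2-point-∈S₂ Sign.+ eq = let open Point₊ eq in
      0<x , 0<y , x≢1 , y≢1 , powEq , j * j , p * (k * k) , 0<a , 0<b , coprime , inj₁ eq , yᵇ≡xᵃ
      where
      coprime : Coprime (j * j) (p * (k * k))
      coprime = let w , j≡1+2w = ±2-root-odd Sign.+ {j} {k} eq in
        coprime-±2 {w = 2 * (w * w + w)} (inj₁ eq) (trans (cong (λ t → t * t) j≡1+2w) (square-of-odd w))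
    ±2-point-∈S₂ Sign.- eq = let open Point₋ eq in
      0<x , 0<y , x≢1 , y≢1 , powEq , j * j , p * (k * k) , 0<a , 0<b , coprime , inj₂ eq , yᵇ≡xᵃ
      where
      coprime : Coprime (j * j) (p * (k * k))
      coprime = let w , j≡1+2w = ±2-root-odd Sign.- {j} {k} eq in
        coprime-±2 {w = 2 * (w * w + w)} (inj₂ eq) (trans (cong (λ t → t * t) j≡1+2w) (square-of-odd w))

    ±2-point-ratio : ∀ s → NormEq p s j k 2 →
      p * (k * k) * exponentˣ p (±2-point s j k) ≡ j * j * exponentʸ p (±2-point s j k)
      × 0 < exponentʸ p (±2-point s j k)
    ±2-point-ratio Sign.+ eq = let open Point₊ eq in exponent-balance , 0<exponentʸ
    ±2-point-ratio Sign.- eq = let open Point₋ eq in exponent-balance , 0<exponentʸ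

  ±2-b-injective : ∀ s {j k j′ k′} → NormEq p s j k 2 → NormEq p s j′ k′ 2 →
    j * j * (p * (k′ * k′)) ≡ j′ * j′ * (p * (k * k)) → p * (k * k) ≡ p * (k′ * k′)
  ±2-b-injective Sign.+ {j} {k} {j′} {k′} a≡b+2 a′≡b′+2 ab′≡a′b =
    +2-cross-injective
      (subst₂ (λ a a′ → a * (p * (k′ * k′)) ≡ a′ * (p * (k * k))) a≡b+2 a′≡b′+2 ab′≡a′b)
  ±2-b-injective Sign.- {j} {k} {j′} {k′} b≡a+2 b′≡a′+2 ab′≡a′b =
    trans b≡a+2 (trans (cong (_+ 2) a≡a′) (sym b′≡a′+2))
    where
    a≡a′ : j * j ≡ j′ * j′
    a≡a′ = +2-cross-injective (begin-equality
      (j * j + 2) * (j′ * j′)   ≡⟨ *-comm (j * j + 2) (j′ * j′) ⟩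
      j′ * j′ * (j * j + 2)     ≡⟨ cong (j′ * j′ *_) b≡a+2 ⟨
      j′ * j′ * (p * (k * k))   ≡⟨ ab′≡a′b ⟨
      j * j * (p * (k′ * k′))   ≡⟨ cong (j * j *_) b′≡a′+2 ⟩
      j * j * (j′ * j′ + 2)     ≡⟨ *-comm (j * j) (j′ * j′ + 2) ⟩
      (j′ * j′ + 2) * (j * j)   ∎)

  private
    U V : ℕ
    U = proj₁ pell
    V = proj₁ (proj₂ pell)
    0<V : 0 < V
    0<V = proj₁ (proj₂ (proj₂ pell))
    unit : NormEq p Sign.+ U V 1
    unit = proj₂ (proj₂ (proj₂ pell))

    initial : ±2Solution p
    initial = ±2-from-pell U 0<V unit

    sign : Sign
    sign = proj₁ initial

  1<U : 1 < U
  1<U = m*m<n*n⇒m<n (begin-strict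
    1                 <⟨ +-monoˡ-< 1 (0<p*square 0<V) ⟩
    p * (V * V) + 1   ≡⟨ unit ⟨
    U * U             ∎)

  next : ℕ × ℕ → ℕ × ℕ
  next (j , k) = j * U + p * k * V , j * V + k * U

  solution : ℕ → ℕ × ℕ
  solution zero    = proj₁ (proj₂ initial) , proj₁ (proj₂ (proj₂ initial))
  solution (suc n) = next (solution n)

  root height : ℕ → ℕ
  root   = proj₁ ∘ solution
  height = proj₂ ∘ solution

  solution-normEq : ∀ n → NormEq p sign (root n) (height n) 2
  solution-normEq zero    = proj₂ (proj₂ (proj₂ (proj₂ initial)))
  solution-normEq (suc n) = NormEq-compose {p} {sign} {root n} {height n} {2} {U} {V} (solution-normEq n) unit

  height-grows : ∀ n → 0 < height n → height n < height (suc n)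
  height-grows n 0<k = begin-strict
    height n                    <⟨ m<m*n (height n) U {{>-nonZero 0<k}} 1<U ⟩
    height n * U                ≤⟨ m≤n+m (height n * U) (root n * V) ⟩
    root n * V + height n * U   ∎

  0<height : ∀ n → 0 < height n
  0<height zero    = proj₁ (proj₂ (proj₂ (proj₂ initial)))
  0<height (suc n) = <-trans (0<height n) (height-grows n (0<height n))

  height-increasing : ∀ {m n} → m < n → height m < height n
  height-increasing {m} {suc n} m<1+n with m≤n⇒m<n∨m≡n (s≤s⁻¹ m<1+n)
  ... | inj₁ m<n  = <-trans (height-increasing m<n) (height-grows n (0<height n))
  ... | inj₂ refl = height-grows m (0<height m)

  height-injective : ∀ {m n} → height m ≡ height n → m ≡ n
  height-injective {m} {n} hm≡hn with <-cmp m n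
  ... | tri< m<n _ _ = contradiction hm≡hn (<⇒≢ (height-increasing m<n))
  ... | tri≈ _ m≡n _ = m≡n
  ... | tri> _ _ n<m = contradiction (sym hm≡hn) (<⇒≢ (height-increasing n<m))

  0<root : ∀ n → 0 < root n
  0<root n = let w , j≡1+2w = ±2-root-odd sign {root n} {height n} (solution-normEq n) in
    subst (0 <_) (sym j≡1+2w) z<s

  2≤height : ∀ n → 2 ≤ height (suc n)
  2≤height n = ≤-trans (s≤s (0<height n)) (height-grows n (0<height n))

  point : ℕ → ℚ × ℚ
  point n = ±2-point sign (root (suc n)) (height (suc n))
              {{>-nonZero (0<root (suc n))}} {{>-nonZero (0<height (suc n))}}

  point-∈S₂ : ∀ n → S₂ p (point n)
  point-∈S₂ n = ±2-point-∈S₂ {{>-nonZero (0<root (suc n))}} {{>-nonZero (0<height (suc n))}}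
    (2≤height n) sign (solution-normEq (suc n))

  point-ratio : ∀ n →
    p * (height (suc n) * height (suc n)) * exponentˣ p (point n) ≡ root (suc n) * root (suc n) * exponentʸ p (point n)
    × 0 < exponentʸ p (point n)
  point-ratio n = ±2-point-ratio {{>-nonZero (0<root (suc n))}} {{>-nonZero (0<height (suc n))}}
    (2≤height n) sign (solution-normEq (suc n))

  point-injective : Injective _≡_ _≡_ point
  point-injective {m} {n} point-m≡point-n =
    suc-injective (height-injective (m*m≡n*n⇒m≡n (*-cancelˡ-≡ _ _ p
      (±2-b-injective sign {root (suc m)} {height (suc m)} {root (suc n)} {height (suc n)}
        (solution-normEq (suc m)) (solution-normEq (suc n)) same-ratio))))
    where
    a b : ℕ → ℕ
    a i = root (suc i) * root (suc i)
    b i = p * (height (suc i) * height (suc i))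
    same-ratio : a m * b n ≡ a n * b m
    same-ratio = ratio-determined {a m} {b m} {a n} {b n} {exponentˣ p (point m)}
      {{>-nonZero (proj₂ (point-ratio m))}} (proj₁ (point-ratio m))
      (subst (λ P → b n * exponentˣ p P ≡ a n * exponentʸ p P) (sym point-m≡point-n) (proj₁ (point-ratio n)))

lemma6 : (p : ℕ) → Prime p → p % 4 ≡ 3 → Infinite (S₂ p)
lemma6 p p-prime p%4≡3 L =
  let n , point∉L = injective-escapes (Product.≡-dec ℚ._≟_ ℚ._≟_) point point-injective L
  in  point n , point-∈S₂ n , point∉L
  where open PointSequence p-prime p%4≡3
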